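{- Let $n\ge 3$ and let $\mathcal{T}_n$ be a uniformly random triangulation of a convex $n$-gon $P_n$ with vertices $v_{n,1},\dots,v_{n,n}$ in cyclic order. Let $\mathcal{S}_n=\sum (j-l)$, where the sum is over all triangles of $\mathcal{T}_n$, a triangle being written with vertices $v_{n,l},v_{n,j},v_{n,r}$ where $l<j<r$. Then $$\mathbb{E}(\mathcal{S}_n)=\frac{2^{2n-5}-\binom{2n-5}{n-2}}{C_{n-2}}.$$
   Context: A triangulation of $P_n$ is a set of $n-3$ noncrossing diagonals partitioning $P_n$ into $n-2$ triangles; there are $C_{n-2}$ of them, where $C_k=\frac{1}{k+1}\binom{2k}{k}$, and $\mathcal{T}_n$ is chosen uniformly among them. In a triangle with vertices $v_{n,l},v_{n,j},v_{n,r}$, $l<j<r$, the angle at $v_{n,r}$ is called blue; when $P_n$ is regular its size is proportional to $j-l$, so $\mathcal{S}_n$ is the total of the blue angles up to a constant factor. -}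

module Defs where

open import Data.Integer using (+_)
open import Data.List using (List; []; _∷_; _++_; map; filter; length; upTo; cartesianProduct)
open import Data.List.Membership.Propositional using (_∈_)
open import Data.List.Relation.Unary.AllPairs using (AllPairs; allPairs?)
open import Data.Nat using (ℕ; suc; _+_; _*_; _∸_; _≤_; _<_; _≟_; _<?_; _!; NonZero; >-nonZero)
open import Data.Nat.Combinatorics using (_C_; nCk≡n!/k![n-k]!; [n∸k]!k!∣n!)
open import Data.Nat.DivMod using (m≥n⇒m/n>0)
open import Data.Nat.Divisibility using (_∣_; ∣⇒≤)
open import Data.Nat.ListAction using (sum)
open import Data.Nat.Properties using (_!≢0; _!*_!≢0; m≤m+n; *-comm)
open import Data.Product using (_×_; _,_)
open import Data.Product.Properties using (≡-dec)
open import Data.Rational using (ℚ; 0ℚ; _/_)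
import Data.Rational as ℚ
import Data.Rational.Properties as ℚ
open import Data.Sum using (_⊎_)
open import Relation.Binary using (Decidable)
open import Relation.Binary.PropositionalEquality using (_≡_; sym; subst)
open import Relation.Nullary using (¬_)
open import Relation.Nullary.Decidable using (¬?; _×-dec_; _⊎-dec_)
import Relation.Unary as U

import Data.List.Membership.DecPropositional as DecMembership

-- The vertex v_{n,i} is represented by its index i, 1 ≤ i ≤ n.
vertices : ℕ → List ℕ
vertices n = map suc (upTo n)

-- A segment between two distinct vertices, the smaller index first.
Chord : Set
Chord = ℕ × ℕ

open DecMembership (≡-dec _≟_ _≟_) using (_∈?_)

IsSide : ℕ → Chord → Set
IsSide n (a , b) = b ≡ suc a ⊎ (a ≡ 1 × b ≡ n)

isSide? : ∀ n → U.Decidable (IsSide n)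
isSide? n (a , b) = (b ≟ suc a) ⊎-dec ((a ≟ 1) ×-dec (b ≟ n))

IsDiagonal : ℕ → Chord → Set
IsDiagonal n (a , b) = a < b × ¬ IsSide n (a , b)

isDiagonal? : ∀ n → U.Decidable (IsDiagonal n)
isDiagonal? n (a , b) = (a <? b) ×-dec ¬? (isSide? n (a , b))

diagonals : ℕ → List Chord
diagonals n = filter (isDiagonal? n) (cartesianProduct (vertices n) (vertices n))

-- Since the polygon is convex, two diagonals meet in their interiors exactly
-- when their endpoints strictly alternate around the polygon.
Crossing : Chord → Chord → Set
Crossing (a , b) (c , d) = (a < c × c < b × b < d) ⊎ (c < a × a < d × d < b)

crossing? : Decidable Crossing
crossing? (a , b) (c , d) =
  ((a <? c) ×-dec ((c <? b) ×-dec (b <? d))) ⊎-dec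
  ((c <? a) ×-dec ((a <? d) ×-dec (d <? b)))

Noncrossing : Chord → Chord → Set
Noncrossing d e = ¬ Crossing d e

noncrossing? : Decidable Noncrossing
noncrossing? d e = ¬? (crossing? d e)

IsEdge : ℕ → List Chord → Chord → Set
IsEdge n D e = IsSide n e ⊎ e ∈ D

isEdge? : ∀ n D → U.Decidable (IsEdge n D)
isEdge? n D e = isSide? n e ⊎-dec (e ∈? D)

Triangle : Set
Triangle = ℕ × ℕ × ℕ

-- The vertices l < j < r span a triangle cut out by the noncrossing set D when
-- each of its three sides is a side of the polygon or belongs to D.  No
-- diagonal of D can enter such a triangle: it would have to cross a side.
IsTriangleOf : ℕ → List Chord → Triangle → Set
IsTriangleOf n D (l , j , r) =
  (l < j × j < r) × (IsEdge n D (l , j) × IsEdge n D (j , r) × IsEdge n D (l , r))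

isTriangleOf? : ∀ n D → U.Decidable (IsTriangleOf n D)
isTriangleOf? n D (l , j , r) =
  ((l <? j) ×-dec (j <? r)) ×-dec
  (isEdge? n D (l , j) ×-dec (isEdge? n D (j , r) ×-dec isEdge? n D (l , r)))

triangles : ℕ → List Chord → List Triangle
triangles n D =
  filter (isTriangleOf? n D)
         (cartesianProduct (vertices n) (cartesianProduct (vertices n) (vertices n)))

-- n ∸ 3 noncrossing diagonals cut the polygon into n ∸ 2 regions, so the last
-- condition says that all of these regions are triangles.
IsTriangulation : ℕ → List Chord → Set
IsTriangulation n D =
  length D ≡ n ∸ 3 × AllPairs Noncrossing D × length (triangles n D) ≡ n ∸ 2

isTriangulation? : ∀ n → U.Decidable (IsTriangulation n)
isTriangulation? n D =
  (length D ≟ n ∸ 3) ×-dec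
  (allPairs? noncrossing? D ×-dec (length (triangles n D) ≟ n ∸ 2))

-- All sublists.  When xs has no repetitions these represent every finite subset
-- of xs exactly once.
subsets : ∀ {A : Set} → List A → List (List A)
subsets []       = [] ∷ []
subsets (x ∷ xs) = subsets xs ++ map (x ∷_) (subsets xs)

triangulations : ℕ → List (List Chord)
triangulations n = filter (isTriangulation? n) (subsets (diagonals n))

-- The monus agrees with j - l, since l < j in every triangle.
𝒮 : ℕ → List Chord → ℕ
𝒮 n D = sum (map (λ (l , j , r) → j ∸ l) (triangles n D))

-- Expectation of f at a uniformly random entry of a repetition-free list; the
-- value on the empty list is a convention.
𝔼 : ∀ {A : Set} → List A → (A → ℕ) → ℚ
𝔼 []          f = 0ℚ
𝔼 xs@(_ ∷ _) f = (+ sum (map f xs)) / length xs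

catalan : ℕ → ℚ
catalan k = (+ ((2 * k) C k)) / suc k

k≤n⇒nCk≢0 : ∀ {n k} → k ≤ n → NonZero (n C k)
k≤n⇒nCk≢0 {n} {k} k≤n =
  >-nonZero (subst (0 <_) (sym (nCk≡n!/k![n-k]! k≤n)) (m≥n⇒m/n>0 (∣⇒≤ k!*[n-k]!∣n!)))
  where
  instance
    _ = n !≢0
    _ = k !* (n ∸ k) !≢0
  k!*[n-k]!∣n! = subst (_∣ n !) (*-comm ((n ∸ k) !) (k !)) ([n∸k]!k!∣n! k≤n)

catalan≢0 : ∀ k → ℚ.NonZero (catalan k)
catalan≢0 k = ℚ.pos⇒nonZero (catalan k) {{ℚ.normalize-pos ((2 * k) C k) (suc k)}}
  where instance _ = k≤n⇒nCk≢0 (m≤m+n k (k + 0))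

{-# OPTIONS --safe #-}

-- A triangulation of the n-gon is a binary tree with n - 2 internal nodes: the root
-- is the triangle on the side from 1 to n, and the subtrees triangulate the two
-- polygons on either side of it.  With C the series of the numbers of trees, A that
-- of the total weights and N = Σ (k + 1) c_k x^k, splitting at the root gives
-- C = 1 + x C² and A = x N C + 2 x A C, and symmetry gives N = 1 + 2 x N C.
-- Multiplying by C eliminates the products: N = 1 + 4 x N - 2 x C and
-- A = 4 x A + x C.  Hence N is the series of the central binomial coefficients
-- and 2 a_k = 4^k - (2k choose k).
module Submission where

open import Defs
open import Data.Integer using (+_; _-_)
import Data.Integer as ℤ
import Data.Integer.Properties as ℤ
open import Data.List
  using (List; []; _∷_; _++_; map; filter; length; cartesianProduct; cartesianProductWith)
open import Data.List.Membership.Propositional using (_∈_; _∉_)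
open import Data.List.Membership.Propositional.Properties
open import Data.List.Membership.Propositional.Properties.WithK using (unique∧set⇒bag)
import Data.List.Membership.DecPropositional as DecMembership
open import Data.List.Properties using (length-++; length-map; map-++; ∷-injectiveʳ; filter-notAll)
open import Data.List.Relation.Binary.BagAndSetEquality using (∼bag⇒↭)
open import Data.List.Relation.Binary.Permutation.Propositional using (_↭_)
import Data.List.Relation.Binary.Permutation.Propositional.Properties as ↭
open import Data.List.Relation.Unary.All as All using ([]; _∷_)
import Data.List.Relation.Unary.All.Properties as All
open import Data.List.Relation.Unary.AllPairs using (AllPairs; []; _∷_)
open import Data.List.Relation.Unary.Any as Any using (here; there)
open import Data.List.Relation.Unary.Unique.Propositional using (Unique)
import Data.List.Relation.Unary.Unique.Propositional.Properties as Unique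
open import Data.Nat hiding (_/_)
open import Data.Nat.Combinatorics
  using (_C_; nCk≡n!/k![n-k]!; k![n∸k]!∣n!; nCk≡nC[n∸k]; nCk+nC[k+1]≡[n+1]C[k+1])
open import Data.Nat.DivMod using (m/n*n≡m)
open import Data.Nat.Induction using (<-rec)
open import Data.Nat.ListAction using (sum)
open import Data.Nat.ListAction.Properties using (sum-++; sum-↭)
open import Data.Nat.Properties
open import Data.Nat.Tactic.RingSolver using (solve-∀)
open import Data.Product using (_×_; _,_; ∃-syntax; proj₁; proj₂)
open import Data.Product.Properties using (≡-dec)
open import Data.Rational using (_/_; _÷_)
import Data.Rational as ℚ
import Data.Rational.Properties as ℚ
import Data.Rational.Unnormalised as ℚᵘ
import Data.Rational.Unnormalised.Properties as ℚᵘ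
open import Data.Sum using (_⊎_; inj₁; inj₂)
open import Function using (_∘_; mk⇔)
open import Relation.Binary using (DecidableEquality; tri<; tri≈; tri>)
open import Relation.Binary.PropositionalEquality hiding ([_])
open import Relation.Nullary using (¬_; yes; no; contradiction)
open import Relation.Unary using (Decidable)

open DecMembership (≡-dec _≟_ _≟_) using (_∈?_)

-- Power series and central binomial coefficients

-- Multiplication by C works because C = 1 + x C² turns each x C² into C - 1. The equation for N
-- becomes N C = C + 2 N (C - 1), that is N C = 2 N - C; the one for A becomes A C = (N + 2 A) (C -
-- 1), that is A C = 2 A + C - N. Substituted back, these leave linear equations, with no square
-- root of 1 - 4x. Coefficients are natural numbers, so every identity is stated with its negative
-- terms moved to the other side. On the geometric side the obstacle is that a triangulation is a
-- list subject to numerical conditions, with no recursive structure. A tree is therefore built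
-- around any noncrossing set of diagonals, and comparing lengths turns the inclusion into an
-- equality.

conv : (ℕ → ℕ) → (ℕ → ℕ) → ℕ → ℕ
conv f g zero    = f 0 * g 0
conv f g (suc n) = f 0 * g (suc n) + conv (f ∘ suc) g n

conv-cong : ∀ {f f′ g g′} n → (∀ {i} → i ≤ n → f i ≡ f′ i) → (∀ {i} → i ≤ n → g i ≡ g′ i) →
            conv f g n ≡ conv f′ g′ n
conv-cong zero    f≗ g≗ = cong₂ _*_ (f≗ z≤n) (g≗ z≤n)
conv-cong (suc n) f≗ g≗ =
  cong₂ _+_ (cong₂ _*_ (f≗ z≤n) (g≗ ≤-refl)) (conv-cong n (f≗ ∘ s≤s) (g≗ ∘ m≤n⇒m≤1+n))

conv-sucʳ : ∀ f g n → conv f g (suc n) ≡ f (suc n) * g 0 + conv f (g ∘ suc) n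
conv-sucʳ f g zero    = +-comm (f 0 * g 1) (f 1 * g 0)
conv-sucʳ f g (suc n) = trans
  (cong (λ z → f 0 * g (suc (suc n)) + z) (conv-sucʳ (f ∘ suc) g n))
  (exchange (f 0 * g (suc (suc n))) (f (suc (suc n)) * g 0) (conv (f ∘ suc) (g ∘ suc) n))
  where
  exchange : ∀ x y z → x + (y + z) ≡ y + (x + z)
  exchange = solve-∀

conv-comm : ∀ f g n → conv f g n ≡ conv g f n
conv-comm f g zero    = *-comm (f 0) (g 0)
conv-comm f g (suc n) = trans
  (cong₂ _+_ (*-comm (f 0) (g (suc n))) (conv-comm (f ∘ suc) g n))
  (sym (conv-sucʳ g f n))

conv-linearˡ : ∀ a f b f′ g n →
               conv (λ i → a * f i + b * f′ i) g n ≡ a * conv f g n + b * conv f′ g n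
conv-linearˡ a f b f′ g zero    = step a (f 0) b (f′ 0) (g 0)
  where
  step : ∀ a f b f′ g → (a * f + b * f′) * g ≡ a * (f * g) + b * (f′ * g)
  step = solve-∀
conv-linearˡ a f b f′ g (suc n) rewrite conv-linearˡ a (f ∘ suc) b (f′ ∘ suc) g n =
  step a (f 0) b (f′ 0) (g (suc n)) (conv (f ∘ suc) g n) (conv (f′ ∘ suc) g n)
  where
  step : ∀ a f b f′ g u v → (a * f + b * f′) * g + (a * u + b * v) ≡ a * (f * g + u) + b * (f′ * g + v)
  step = solve-∀

-- The operator x d/dx is a derivation: in each product `f i * g j` of the coefficient, `i + j = n`.
conv-Leibniz : ∀ f g n →
               conv (λ i → i * f i) g n + conv f (λ i → i * g i) n ≡ n * conv f g n
conv-Leibniz f g zero    = *-zeroʳ (f 0)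
conv-Leibniz f g (suc n) = begin
  conv (λ i → suc i * f (suc i)) g n + (f 0 * (suc n * g (suc n)) + conv (f ∘ suc) (λ i → i * g i) n)
    ≡⟨ cong (_+ (f 0 * (suc n * g (suc n)) + w))
            (trans (conv-cong {g = g} n (λ {i} _ → split i (f (suc i))) (λ _ → refl))
                   (conv-linearˡ 1 (f ∘ suc) 1 (λ i → i * f (suc i)) g n)) ⟩
  1 * u + 1 * v + (f 0 * (suc n * g (suc n)) + w)
    ≡⟨ regroup u v (f 0) n (g (suc n)) w ⟩
  suc n * (f 0 * g (suc n)) + (u + (v + w))
    ≡⟨ cong (λ z → suc n * (f 0 * g (suc n)) + (u + z)) (conv-Leibniz (f ∘ suc) g n) ⟩
  suc n * (f 0 * g (suc n)) + suc n * u
    ≡⟨ *-distribˡ-+ (suc n) (f 0 * g (suc n)) u ⟨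
  suc n * (f 0 * g (suc n) + u) ∎
  where
  open ≡-Reasoning
  u = conv (f ∘ suc) g n
  v = conv (λ i → i * f (suc i)) g n
  w = conv (f ∘ suc) (λ i → i * g i) n
  split : ∀ i x → suc i * x ≡ 1 * x + 1 * (i * x)
  split = solve-∀
  regroup : ∀ u v x n y w →
            1 * u + 1 * v + (x * (suc n * y) + w) ≡ suc n * (x * y) + (u + (v + w))
  regroup = solve-∀

C*factorials : ∀ {n k} → k ≤ n → (n C k) * (k ! * (n ∸ k) !) ≡ n !
C*factorials {n} {k} k≤n = trans
  (cong (_* (k ! * (n ∸ k) !)) (nCk≡n!/k![n-k]! k≤n))
  (m/n*n≡m (k![n∸k]!∣n! k≤n))
  where instance _ = k !* (n ∸ k) !≢0

centralBinomial-factorials : ∀ k → ((2 * k) C k) * (k ! * k !) ≡ (2 * k) !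
centralBinomial-factorials k =
  subst (λ j → ((2 * k) C k) * (k ! * j !) ≡ (2 * k) !)
        (trans (m+n∸m≡n k (k + 0)) (+-identityʳ k))
        (C*factorials (m≤m+n k (k + 0)))

-- Multiplied by `suc k * (k ! * k !)`, both sides become `(2 * suc k) !`; the factor 4k + 2 comes
-- from (2k + 2)(2k + 1) = (k + 1)(4k + 2).
centralBinomial-suc : ∀ k → suc k * ((2 * suc k) C (suc k)) ≡ (4 * k + 2) * ((2 * k) C k)
centralBinomial-suc k = *-cancelʳ-≡ _ _ (suc k * (k ! * k !)) (begin
  suc k * b′ * (suc k * (k ! * k !))               ≡⟨ spread k b′ (k !) ⟩
  b′ * (suc k * k ! * (suc k * k !))               ≡⟨ centralBinomial-factorials (suc k) ⟩
  (2 * suc k) !                                    ≡⟨ cong _! (2+2k k) ⟩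
  suc (suc (2 * k)) * (suc (2 * k) * (2 * k) !)
    ≡⟨ cong (λ x → suc (suc (2 * k)) * (suc (2 * k) * x)) (centralBinomial-factorials k) ⟨
  suc (suc (2 * k)) * (suc (2 * k) * (b * (k ! * k !)))
    ≡⟨ collect k b (k ! * k !) ⟩
  (4 * k + 2) * b * (suc k * (k ! * k !)) ∎)
  where
  open ≡-Reasoning
  b  = (2 * k) C k
  b′ = (2 * suc k) C (suc k)
  instance
    _ = k !* k !≢0
    _ = m*n≢0 (suc k) (k ! * k !)
  2+2k : ∀ k → 2 * suc k ≡ suc (suc (2 * k))
  2+2k = solve-∀
  spread : ∀ k b f → suc k * b * (suc k * (f * f)) ≡ b * (suc k * f * (suc k * f))
  spread = solve-∀
  collect : ∀ k b f → suc (suc (2 * k)) * (suc (2 * k) * (b * f)) ≡ (4 * k + 2) * b * (suc k * f)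
  collect = solve-∀

module Recurrences
  (c A : ℕ → ℕ)
  (c-zero : c 0 ≡ 1) (c-suc : ∀ k → c (suc k) ≡ conv c c k)
  (A-zero : A 0 ≡ 0)
  (A-suc : ∀ k → A (suc k) ≡ conv (λ i → suc i * c i + A i) c k + conv c A k)
  where

  -- A binary tree with `k` internal nodes has `suc k` leaves, so this is the total number of leaves
  -- over all trees of size `k`. It enters because the root triangle contributes the number of
  -- leaves of the left subtree.
  N : ℕ → ℕ
  N k = suc k * c k

  -- For `i + j = k` the factor k + 2 splits as (i + 1) + (j + 1), and commutativity of `conv` makes
  -- the two halves equal.
  N-suc : ∀ k → N (suc k) ≡ 2 * conv N c k
  N-suc k = begin
    suc (suc k) * c (suc k)                  ≡⟨ cong (suc (suc k) *_) (c-suc k) ⟩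
    suc (suc k) * w                          ≡⟨ split k w ⟩
    2 * w + k * w                            ≡⟨ cong (λ z → 2 * w + z) (conv-Leibniz c c k) ⟨
    2 * w + (v + conv c (λ i → i * c i) k)   ≡⟨ cong (λ z → 2 * w + (v + z)) (conv-comm c _ k) ⟩
    2 * w + (v + v)                          ≡⟨ double w v ⟩
    2 * (1 * w + 1 * v)                      ≡⟨ cong (2 *_) (conv-linearˡ 1 c 1 (λ i → i * c i) c k) ⟨
    2 * conv (λ i → 1 * c i + 1 * (i * c i)) c k
      ≡⟨ cong (2 *_) (conv-cong {g = c} k (λ {i} _ → merge i (c i)) (λ _ → refl)) ⟩
    2 * conv N c k ∎
    where
    open ≡-Reasoning
    w = conv c c k
    v = conv (λ i → i * c i) c k
    split : ∀ k w → suc (suc k) * w ≡ 2 * w + k * w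
    split = solve-∀
    double : ∀ w v → 2 * w + (v + v) ≡ 2 * (1 * w + 1 * v)
    double = solve-∀
    merge : ∀ i x → 1 * x + 1 * (i * x) ≡ suc i * x
    merge = solve-∀

  A-suc′ : ∀ k → A (suc k) ≡ conv N c k + 2 * conv A c k
  A-suc′ k = begin
    A (suc k)                                        ≡⟨ A-suc k ⟩
    conv (λ i → N i + A i) c k + conv c A k
      ≡⟨ cong₂ _+_ (trans (conv-cong {g = c} k (λ {i} _ → ones (N i) (A i)) (λ _ → refl))
                          (conv-linearˡ 1 N 1 A c k))
                   (conv-comm c A k) ⟩
    1 * conv N c k + 1 * conv A c k + conv A c k     ≡⟨ collect (conv N c k) (conv A c k) ⟩
    conv N c k + 2 * conv A c k                      ∎
    where
    open ≡-Reasoning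
    ones : ∀ x y → x + y ≡ 1 * x + 1 * y
    ones = solve-∀
    collect : ∀ x y → 1 * x + 1 * y + y ≡ x + 2 * y
    collect = solve-∀

  -- With C = 1 + x C² and N = 1 + 2 x N C this is N C + C = 2 N; the induction
  -- replaces multiplying by C.
  convNc : ∀ k → conv N c k + c k ≡ 2 * N k
  convNc = <-rec _ step
    where
    step : ∀ k → (∀ {i} → i < k → conv N c i + c i ≡ 2 * N i) → conv N c k + c k ≡ 2 * N k
    step zero    _  rewrite c-zero = refl
    step (suc k) ih = begin
      N 0 * c (suc k) + conv (N ∘ suc) c k + c (suc k)
        ≡⟨ cong₂ (λ x y → x * c (suc k) + y + c (suc k)) N-zero tail ⟩
      1 * c (suc k) + X + c (suc k)                  ≡⟨ shuffle (c (suc k)) X ⟩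
      X + 2 * c (suc k)                              ≡⟨ cong (λ z → X + 2 * z) (c-suc k) ⟩
      X + 2 * conv c c k                             ≡⟨ eqn ⟩
      4 * conv N c k                                 ≡⟨ double (conv N c k) ⟩
      2 * (2 * conv N c k)                           ≡⟨ cong (2 *_) (N-suc k) ⟨
      2 * N (suc k)                                  ∎
      where
      open ≡-Reasoning
      X = conv (λ i → 2 * conv N c i) c k
      N-zero : N 0 ≡ 1
      N-zero rewrite c-zero = refl
      tail : conv (N ∘ suc) c k ≡ X
      tail = conv-cong {g = c} k (λ {i} _ → N-suc i) (λ _ → refl)
      shuffle : ∀ x y → 1 * x + y + x ≡ y + 2 * x
      shuffle = solve-∀
      double : ∀ x → 4 * x ≡ 2 * (2 * x)
      double = solve-∀
      -- The induction hypothesis covers every index up to `k`, so twice it can be convolved with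
      -- `c` as a whole. The summand `0 * N i` only gives the right side the shape required by
      -- `conv-linearˡ`.
      pointwise : ∀ {i} → i ≤ k → 1 * (2 * conv N c i) + 2 * c i ≡ 4 * N i + 0 * N i
      pointwise {i} i≤k = trans (factor (conv N c i) (c i))
        (trans (cong (2 *_) (ih (s≤s i≤k))) (expand (N i)))
        where
        factor : ∀ x y → 1 * (2 * x) + 2 * y ≡ 2 * (x + y)
        factor = solve-∀
        expand : ∀ x → 2 * (2 * x) ≡ 4 * x + 0 * x
        expand = solve-∀
      eqn : X + 2 * conv c c k ≡ 4 * conv N c k
      eqn = begin
        X + 2 * conv c c k                 ≡⟨ cong (_+ 2 * conv c c k) (*-identityˡ X) ⟨
        1 * X + 2 * conv c c k             ≡⟨ conv-linearˡ 1 (λ i → 2 * conv N c i) 2 c c k ⟨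
        conv (λ i → 1 * (2 * conv N c i) + 2 * c i) c k
                                           ≡⟨ conv-cong {g = c} k pointwise (λ _ → refl) ⟩
        conv (λ i → 4 * N i + 0 * N i) c k ≡⟨ conv-linearˡ 4 N 0 N c k ⟩
        4 * conv N c k + 0                 ≡⟨ +-identityʳ _ ⟩
        4 * conv N c k                     ∎

  -- The value of A C at `k` needs this recurrence only below `k`, and the recurrence at `k` needs
  -- that value; one strong induction yields both.
  A-recurrence : ∀ k → A (suc k) ≡ 4 * A k + c k
  A-recurrence = <-rec _ step
    where
    open ≡-Reasoning
    -- C A = 2 A + C - N, the analogue of convNc.
    convAc : ∀ k → (∀ {i} → i < k → A (suc i) ≡ 4 * A i + c i) →
             N k + conv A c k ≡ 2 * A k + c k
    convAc zero    _  rewrite A-zero | c-zero = refl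
    convAc (suc k) ih = begin
      N (suc k) + (A 0 * c (suc k) + conv (A ∘ suc) c k)
        ≡⟨ cong₂ (λ x y → N (suc k) + (x * c (suc k) + y)) A-zero tail ⟩
      N (suc k) + (4 * conv A c k + 1 * conv c c k)
        ≡⟨ cong₂ (λ x y → x + (4 * conv A c k + 1 * y)) (N-suc k) (sym (c-suc k)) ⟩
      2 * conv N c k + (4 * conv A c k + 1 * c (suc k))
        ≡⟨ collect (conv N c k) (conv A c k) (c (suc k)) ⟩
      2 * (conv N c k + 2 * conv A c k) + c (suc k)
        ≡⟨ cong (λ x → 2 * x + c (suc k)) (A-suc′ k) ⟨
      2 * A (suc k) + c (suc k) ∎
      where
      collect : ∀ x y z → 2 * x + (4 * y + 1 * z) ≡ 2 * (x + 2 * y) + z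
      collect = solve-∀
      tail : conv (A ∘ suc) c k ≡ 4 * conv A c k + 1 * conv c c k
      tail = trans
        (conv-cong {g = c} k
          (λ {i} i≤k → trans (ih (s≤s i≤k)) (cong (λ z → 4 * A i + z) (sym (*-identityˡ (c i)))))
          (λ _ → refl))
        (conv-linearˡ 4 A 1 c c k)
    step : ∀ k → (∀ {i} → i < k → A (suc i) ≡ 4 * A i + c i) → A (suc k) ≡ 4 * A k + c k
    -- The added `c k` completes `convNc`, and the added `2 * N k` completes twice `convAc`; the
    -- same amount reappears on the right and cancels.
    step k ih = +-cancelʳ-≡ (c k + 2 * N k) _ _ (begin
      A (suc k) + (c k + 2 * N k)
        ≡⟨ cong (_+ (c k + 2 * N k)) (A-suc′ k) ⟩
      conv N c k + 2 * conv A c k + (c k + 2 * N k)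
        ≡⟨ regroup (conv N c k) (conv A c k) (c k) (N k) ⟩
      conv N c k + c k + 2 * (N k + conv A c k)
        ≡⟨ cong₂ (λ x y → x + 2 * y) (convNc k) (convAc k ih) ⟩
      2 * N k + 2 * (2 * A k + c k)
        ≡⟨ regroup′ (A k) (c k) (N k) ⟩
      4 * A k + c k + (c k + 2 * N k) ∎)
      where
      regroup : ∀ x y z w → x + 2 * y + (z + 2 * w) ≡ x + z + 2 * (w + y)
      regroup = solve-∀
      regroup′ : ∀ x y z → 2 * z + 2 * (2 * x + y) ≡ 4 * x + y + (y + 2 * z)
      regroup′ = solve-∀

  -- The linear equation reads N(k+1) = 4 N(k) - 2 c(k), and N(k) = (k + 1) c(k) makes the right
  -- side (4k + 2) c(k). This is the ratio of consecutive central binomial coefficients, whence the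
  -- Catalan formula for `c`.
  N-recurrence : ∀ k → suc k * N (suc k) ≡ (4 * k + 2) * N k
  N-recurrence k = begin
    suc k * N (suc k)        ≡⟨ cong (suc k *_) (+-cancelʳ-≡ (2 * c k) _ _ shifted) ⟩
    suc k * ((4 * k + 2) * c k) ≡⟨ reorder k (c k) ⟩
    (4 * k + 2) * N k        ∎
    where
    open ≡-Reasoning
    reorder : ∀ k x → suc k * ((4 * k + 2) * x) ≡ (4 * k + 2) * (suc k * x)
    reorder = solve-∀
    double : ∀ k x → 2 * (2 * (suc k * x)) ≡ (4 * k + 2) * x + 2 * x
    double = solve-∀
    shifted : N (suc k) + 2 * c k ≡ (4 * k + 2) * c k + 2 * c k
    shifted = begin
      N (suc k) + 2 * c k            ≡⟨ cong (_+ 2 * c k) (N-suc k) ⟩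
      2 * conv N c k + 2 * c k       ≡⟨ *-distribˡ-+ 2 (conv N c k) (c k) ⟨
      2 * (conv N c k + c k)         ≡⟨ cong (2 *_) (convNc k) ⟩
      2 * (2 * N k)                  ≡⟨ double k (c k) ⟩
      (4 * k + 2) * c k + 2 * c k    ∎

  N≡centralBinomial : ∀ k → N k ≡ (2 * k) C k
  N≡centralBinomial zero    rewrite c-zero = refl
  N≡centralBinomial (suc k) = *-cancelˡ-≡ _ _ (suc k) (begin
    suc k * N (suc k)                ≡⟨ N-recurrence k ⟩
    (4 * k + 2) * N k                ≡⟨ cong ((4 * k + 2) *_) (N≡centralBinomial k) ⟩
    (4 * k + 2) * ((2 * k) C k)      ≡⟨ centralBinomial-suc k ⟨
    suc k * ((2 * suc k) C (suc k))  ∎)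
    where open ≡-Reasoning

  -- Passing from `k` to `k + 1`, 2 A gains 2 c(k) beyond the factor 4 and N loses 2 c(k), so the
  -- sum 2 A + N is exactly multiplied by 4.
  A-closed : ∀ k → 2 * A k + ((2 * k) C k) ≡ 4 ^ k
  A-closed zero    rewrite A-zero = refl
  A-closed (suc k) = begin
    2 * A (suc k) + ((2 * suc k) C (suc k))
      ≡⟨ cong₂ (λ x y → 2 * x + y) (A-recurrence k) (sym (N≡centralBinomial (suc k))) ⟩
    2 * (4 * A k + c k) + N (suc k)         ≡⟨ cong (λ z → 2 * (4 * A k + c k) + z) (N-suc k) ⟩
    2 * (4 * A k + c k) + 2 * conv N c k    ≡⟨ collect (A k) (c k) (conv N c k) ⟩
    8 * A k + 2 * (conv N c k + c k)        ≡⟨ cong (λ x → 8 * A k + 2 * x) (convNc k) ⟩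
    8 * A k + 2 * (2 * N k)                 ≡⟨ factor (A k) (N k) ⟩
    4 * (2 * A k + N k)                     ≡⟨ cong (λ x → 4 * (2 * A k + x)) (N≡centralBinomial k) ⟩
    4 * (2 * A k + ((2 * k) C k))             ≡⟨ cong (4 *_) (A-closed k) ⟩
    4 ^ suc k                               ∎
    where
    open ≡-Reasoning
    collect : ∀ a c x → 2 * (4 * a + c) + 2 * x ≡ 8 * a + 2 * (x + c)
    collect = solve-∀
    factor : ∀ a n → 8 * a + 2 * (2 * n) ≡ 4 * (2 * a + n)
    factor = solve-∀

-- Binary trees by size

data Tree : Set where
  leaf : Tree
  node : Tree → Tree → Tree

size : Tree → ℕ
size leaf       = 0
size (node l r) = suc (size l + size r)

-- suc (size l), the number of leaves of l, is the term j - l of the triangle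
-- at the root.
weight : Tree → ℕ
weight leaf       = 0
weight (node l r) = (suc (size l) + weight l) + weight r

-- The recursion is that of `conv`, with products of lists in place of products of numbers, so
-- lengths and sums of weights turn into convolutions clause by clause.
joins : (F G : ℕ → List Tree) → ℕ → List Tree
joins F G zero    = cartesianProductWith node (F 0) (G 0)
joins F G (suc n) = cartesianProductWith node (F 0) (G (suc n)) ++ joins (F ∘ suc) G n

joins-cong : ∀ {F F′ G G′} n → (∀ {i} → i ≤ n → F i ≡ F′ i) → (∀ {i} → i ≤ n → G i ≡ G′ i) →
             joins F G n ≡ joins F′ G′ n
joins-cong zero    F≗ G≗ = cong₂ (cartesianProductWith node) (F≗ z≤n) (G≗ z≤n)
joins-cong (suc n) F≗ G≗ =
  cong₂ _++_ (cong₂ (cartesianProductWith node) (F≗ z≤n) (G≗ ≤-refl))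
             (joins-cong n (F≗ ∘ s≤s) (G≗ ∘ m≤n⇒m≤1+n))

∈-joins⁺ : ∀ {F G l r} i j → l ∈ F i → r ∈ G j → node l r ∈ joins F G (i + j)
∈-joins⁺ zero    zero    l∈ r∈ = ∈-cartesianProductWith⁺ node l∈ r∈
∈-joins⁺ zero    (suc j) l∈ r∈ = ∈-++⁺ˡ (∈-cartesianProductWith⁺ node l∈ r∈)
∈-joins⁺ {F} {G} (suc i) j l∈ r∈ =
  ∈-++⁺ʳ (cartesianProductWith node (F 0) (G (suc (i + j)))) (∈-joins⁺ i j l∈ r∈)

∈-joins⁻ : ∀ {F G t} n → t ∈ joins F G n →
           ∃[ i ] ∃[ j ] ∃[ l ] ∃[ r ] i + j ≡ n × l ∈ F i × r ∈ G j × t ≡ node l r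
∈-joins⁻ {F} {G} zero t∈
  with l , r , l∈ , r∈ , t≡ ← ∈-cartesianProductWith⁻ node (F 0) (G 0) t∈ =
  0 , 0 , l , r , refl , l∈ , r∈ , t≡
∈-joins⁻ {F} {G} (suc n) t∈
  with ∈-++⁻ (cartesianProductWith node (F 0) (G (suc n))) t∈
... | inj₁ t∈′
  with l , r , l∈ , r∈ , t≡ ← ∈-cartesianProductWith⁻ node (F 0) (G (suc n)) t∈′ =
  0 , suc n , l , r , refl , l∈ , r∈ , t≡
... | inj₂ t∈′
  with i , j , l , r , i+j≡n , l∈ , r∈ , t≡ ← ∈-joins⁻ n t∈′ =
  suc i , j , l , r , cong suc i+j≡n , l∈ , r∈ , t≡

node-injective : ∀ {l l′ r r′} → node l r ≡ node l′ r′ → l ≡ l′ × r ≡ r′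
node-injective refl = refl , refl

-- A join determines its left subtree, and the last hypothesis makes that subtree determine the
-- index `i`; hence the summands of `joins` are disjoint.
joins-unique : ∀ {F G} → (∀ i → Unique (F i)) → (∀ i → Unique (G i)) →
               (∀ {i j l} → l ∈ F i → l ∈ F j → i ≡ j) → ∀ n → Unique (joins F G n)
joins-unique uF uG F-disjoint zero    = Unique.cartesianProductWith⁺ node node-injective (uF 0) (uG 0)
joins-unique {F} {G} uF uG F-disjoint (suc n) = Unique.++⁺
  (Unique.cartesianProductWith⁺ node node-injective (uF 0) (uG (suc n)))
  (joins-unique (uF ∘ suc) uG (λ l∈ l∈′ → suc-injective (F-disjoint l∈ l∈′)) n)
  disjoint
  where
  disjoint : ∀ {t} → t ∈ cartesianProductWith node (F 0) (G (suc n)) × t ∈ joins (F ∘ suc) G n → _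
  disjoint (t∈ , t∈′)
    with _ , _ , l∈ , _ , refl ← ∈-cartesianProductWith⁻ node (F 0) (G (suc n)) t∈
       | _ , _ , _ , _ , _ , l∈′ , _ , refl ← ∈-joins⁻ n t∈′
    with () ← F-disjoint l∈ l∈′

length-joins : ∀ F G n → length (joins F G n) ≡ conv (length ∘ F) (length ∘ G) n
length-joins F G = go F
  where
  length-product : ∀ ls rs → length (cartesianProductWith node ls rs) ≡ length ls * length rs
  length-product []       rs = refl
  length-product (l ∷ ls) rs = trans (length-++ (map (node l) rs))
    (cong₂ _+_ (length-map (node l) rs) (length-product ls rs))
  go : ∀ F n → length (joins F G n) ≡ conv (length ∘ F) (length ∘ G) n
  go F zero    = length-product (F 0) (G 0)
  go F (suc n) = trans (length-++ (cartesianProductWith node (F 0) (G (suc n))))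
    (cong₂ _+_ (length-product (F 0) (G (suc n))) (go (F ∘ suc) n))

sum-map-++ : ∀ {A : Set} (f : A → ℕ) xs ys →
             sum (map f (xs ++ ys)) ≡ sum (map f xs) + sum (map f ys)
sum-map-++ f xs ys = trans (cong sum (map-++ f xs ys)) (sum-++ (map f xs) (map f ys))

module _ {w α β : Tree → ℕ} (w-node : ∀ l r → w (node l r) ≡ α l + β r) where

  private
    interchange : ∀ a s n p q → a * n + s + (p * n + q) ≡ (a + p) * n + (s + q)
    interchange = solve-∀

  sum-product : ∀ ls rs → sum (map w (cartesianProductWith node ls rs)) ≡
                sum (map α ls) * length rs + length ls * sum (map β rs)
  sum-product []       rs = refl
  sum-product (l ∷ ls) rs = begin
    sum (map w (map (node l) rs ++ cartesianProductWith node ls rs))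
      ≡⟨ sum-map-++ w (map (node l) rs) _ ⟩
    sum (map w (map (node l) rs)) + sum (map w (cartesianProductWith node ls rs))
      ≡⟨ cong₂ _+_ (row rs) (sum-product ls rs) ⟩
    α l * length rs + sum (map β rs) + (sum (map α ls) * length rs + length ls * sum (map β rs))
      ≡⟨ interchange (α l) (sum (map β rs)) (length rs) (sum (map α ls)) _ ⟩
    (α l + sum (map α ls)) * length rs + (sum (map β rs) + length ls * sum (map β rs)) ∎
    where
    open ≡-Reasoning
    extend : ∀ a b n s → a + b + (a * n + s) ≡ a * suc n + (b + s)
    extend = solve-∀
    row : ∀ rs → sum (map w (map (node l) rs)) ≡ α l * length rs + sum (map β rs)
    row []       = sym (trans (+-identityʳ _) (*-zeroʳ (α l)))
    row (r ∷ rs) = trans (cong₂ _+_ (w-node l r) (row rs)) (extend (α l) (β r) (length rs) _)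

  -- Product rule: the contribution of a left tree is counted once for each right tree of
  -- complementary size, and conversely. For `weight`, the term of the root depends on the left
  -- subtree alone and is put into `α`.
  sum-joins : ∀ F G n → sum (map w (joins F G n)) ≡
              conv (sum ∘ map α ∘ F) (length ∘ G) n + conv (length ∘ F) (sum ∘ map β ∘ G) n
  sum-joins F G zero    = sum-product (F 0) (G 0)
  sum-joins F G (suc n) = begin
    sum (map w (cartesianProductWith node (F 0) (G (suc n)) ++ joins (F ∘ suc) G n))
      ≡⟨ sum-map-++ w (cartesianProductWith node (F 0) (G (suc n))) _ ⟩
    _ ≡⟨ cong₂ _+_ (sum-product (F 0) (G (suc n))) (sum-joins (F ∘ suc) G n) ⟩
    p + q + (p′ + q′) ≡⟨ swap p q p′ q′ ⟩
    p + p′ + (q + q′) ∎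
    where
    open ≡-Reasoning
    p  = sum (map α (F 0)) * length (G (suc n))
    q  = length (F 0) * sum (map β (G (suc n)))
    p′ = conv (sum ∘ map α ∘ F ∘ suc) (length ∘ G) n
    q′ = conv (length ∘ F ∘ suc) (sum ∘ map β ∘ G) n
    swap : ∀ p q p′ q′ → p + q + (p′ + q′) ≡ p + p′ + (q + q′)
    swap = solve-∀

-- The trees of size k and height less than h.
treesBelow : ℕ → ℕ → List Tree
treesBelow zero    k       = []
treesBelow (suc h) zero    = leaf ∷ []
treesBelow (suc h) (suc k) = joins (treesBelow h) (treesBelow h) k

-- The height of a tree is at most its size, so the bound `suc k` excludes nothing. The bound serves
-- to make the recursion structural, as the sizes of the two subtrees range over all smaller
-- numbers.
trees : ℕ → List Tree
trees k = treesBelow (suc k) k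

treesBelow-stable : ∀ {h h′ k} → k < h → k < h′ → treesBelow h k ≡ treesBelow h′ k
treesBelow-stable {suc h} {suc h′} {zero}  _         _          = refl
treesBelow-stable {suc h} {suc h′} {suc k} (s<s k<h) (s<s k<h′) = joins-cong k stable stable
  where
  stable : ∀ {i} → i ≤ k → treesBelow h i ≡ treesBelow h′ i
  stable i≤k = treesBelow-stable (≤-<-trans i≤k k<h) (≤-<-trans i≤k k<h′)

trees-suc : ∀ k → trees (suc k) ≡ joins trees trees k
trees-suc k = joins-cong k stable stable
  where
  stable : ∀ {i} → i ≤ k → treesBelow (suc k) i ≡ trees i
  stable {i} i≤k = treesBelow-stable (s≤s i≤k) (n<1+n i)

∈-treesBelow⇒size : ∀ h {k t} → t ∈ treesBelow h k → size t ≡ k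
∈-treesBelow⇒size (suc h) {zero}  (here refl) = refl
∈-treesBelow⇒size (suc h) {suc k} t∈
  with _ , _ , _ , _ , i+j≡k , l∈ , r∈ , refl ← ∈-joins⁻ k t∈ =
  cong suc (trans (cong₂ _+_ (∈-treesBelow⇒size h l∈) (∈-treesBelow⇒size h r∈)) i+j≡k)

∈-trees⁻ : ∀ {k t} → t ∈ trees k → size t ≡ k
∈-trees⁻ {k} = ∈-treesBelow⇒size (suc k)

∈-trees⁺ : ∀ t → t ∈ trees (size t)
∈-trees⁺ leaf       = here refl
∈-trees⁺ (node l r) = subst (node l r ∈_) (sym (trees-suc (size l + size r)))
  (∈-joins⁺ (size l) (size r) (∈-trees⁺ l) (∈-trees⁺ r))

treesBelow-unique : ∀ h k → Unique (treesBelow h k)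
treesBelow-unique zero    k       = []
treesBelow-unique (suc h) zero    = [] ∷ []
treesBelow-unique (suc h) (suc k) = joins-unique (treesBelow-unique h) (treesBelow-unique h)
  (λ l∈ l∈′ → trans (sym (∈-treesBelow⇒size h l∈)) (∈-treesBelow⇒size h l∈′)) k

countTrees : ℕ → ℕ
countTrees k = length (trees k)

totalWeight : ℕ → ℕ
totalWeight k = sum (map weight (trees k))

countTrees-suc : ∀ k → countTrees (suc k) ≡ conv countTrees countTrees k
countTrees-suc k = trans (cong length (trees-suc k)) (length-joins trees trees k)

totalWeight-suc : ∀ k → totalWeight (suc k) ≡
                  conv (λ i → suc i * countTrees i + totalWeight i) countTrees k +
                  conv countTrees totalWeight k
totalWeight-suc k = begin
  totalWeight (suc k)                       ≡⟨ cong (sum ∘ map weight) (trees-suc k) ⟩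
  sum (map weight (joins trees trees k))    ≡⟨ sum-joins {weight} {α} {weight} (λ l r → refl) trees trees k ⟩
  conv (sum ∘ map α ∘ trees) countTrees k + conv countTrees totalWeight k
    ≡⟨ cong (_+ conv countTrees totalWeight k)
            (conv-cong {g = countTrees} k (λ {i} _ → sum-α {i} (trees i) (∈-trees⁻ {i})) (λ _ → refl)) ⟩
  conv (λ i → suc i * countTrees i + totalWeight i) countTrees k + conv countTrees totalWeight k ∎
  where
  open ≡-Reasoning
  α : Tree → ℕ
  α t = suc (size t) + weight t
  extend : ∀ i w n s → suc i + w + (suc i * n + s) ≡ suc i * suc n + (w + s)
  extend = solve-∀
  sum-α : ∀ {i} ts → (∀ {t} → t ∈ ts → size t ≡ i) →
          sum (map α ts) ≡ suc i * length ts + sum (map weight ts)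
  sum-α {i} []       _     = sym (trans (+-identityʳ _) (*-zeroʳ (suc i)))
  sum-α {i} (t ∷ ts) size≡ = trans
    (cong₂ (λ s x → suc s + weight t + x) (size≡ (here refl)) (sum-α ts (size≡ ∘ there)))
    (extend i (weight t) (length ts) (sum (map weight ts)))

open Recurrences countTrees totalWeight refl countTrees-suc refl totalWeight-suc
  using () renaming (N≡centralBinomial to countTrees-closed; A-closed to totalWeight-closed)

-- Trees drawn in a polygon

-- A tree with m leaves, drawn over the vertices a, …, a + m, where end a t = a + m:
-- the leaves are the sides, the internal nodes the triangles, and each subtree
-- is cut off by a chord.  In particular the chord of the whole tree is included.
end : ℕ → Tree → ℕ
end a leaf       = suc a
end a (node l r) = end (end a l) r

chords : ℕ → Tree → List Chord
chords a leaf       = []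
chords a (node l r) = (a , end (end a l) r) ∷ chords a l ++ chords (end a l) r

treeTriangles : ℕ → Tree → List Triangle
treeTriangles a leaf       = []
treeTriangles a (node l r) =
  (a , end a l , end (end a l) r) ∷ treeTriangles a l ++ treeTriangles (end a l) r

-- The counterpart of `IsEdge` for a subtree. The long side of the polygon is covered as the chord
-- of the root, and the side case does not mention the tree, so passing between a tree and its
-- subtrees affects only the chord case.
Edge : ℕ → Tree → Chord → Set
Edge a t (x , y) = y ≡ suc x ⊎ (x , y) ∈ chords a t

end≡ : ∀ a t → end a t ≡ suc (size t) + a
end≡ a leaf       = refl
end≡ a (node l r) = begin
  end (end a l) r                        ≡⟨ end≡ (end a l) r ⟩
  suc (size r) + end a l                 ≡⟨ cong (λ z → suc (size r) + z) (end≡ a l) ⟩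
  suc (size r) + (suc (size l) + a)      ≡⟨ +-assoc (suc (size r)) (suc (size l)) a ⟨
  suc (size r) + suc (size l) + a        ≡⟨ cong (_+ a) (+-comm (suc (size r)) (suc (size l))) ⟩
  suc (size l + suc (size r)) + a        ≡⟨ cong (λ s → suc s + a) (+-suc (size l) (size r)) ⟩
  suc (size (node l r)) + a              ∎
  where open ≡-Reasoning

a<end : ∀ a t → a < end a t
a<end a t = subst (a <_) (sym (end≡ a t)) (s≤s (m≤n+m a (size t)))

length-chords : ∀ a t → length (chords a t) ≡ size t
length-chords a leaf       = refl
length-chords a (node l r) = cong suc (trans (length-++ (chords a l))
  (cong₂ _+_ (length-chords a l) (length-chords (end a l) r)))

data ∈Node (a : ℕ) (l r : Tree) : Chord → Set where
  root  : ∈Node a l r (a , end (end a l) r)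
  left  : ∀ {c} → c ∈ chords a l → ∈Node a l r c
  right : ∀ {c} → c ∈ chords (end a l) r → ∈Node a l r c

∈-node⁻ : ∀ {a c} l r → c ∈ chords a (node l r) → ∈Node a l r c
∈-node⁻     l r (here refl) = root
∈-node⁻ {a} l r (there c∈) with ∈-++⁻ (chords a l) c∈
... | inj₁ c∈l = left c∈l
... | inj₂ c∈r = right c∈r

∈-left : ∀ {a c} l r → c ∈ chords a l → c ∈ chords a (node l r)
∈-left l r = there ∘ ∈-++⁺ˡ

∈-right : ∀ {a c} l r → c ∈ chords (end a l) r → c ∈ chords a (node l r)
∈-right {a} l r = there ∘ ∈-++⁺ʳ (chords a l)

chords-bounds : ∀ {a x y} t → (x , y) ∈ chords a t → a ≤ x × suc x < y × y ≤ end a t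
chords-bounds {a} (node l r) c∈ with ∈-node⁻ l r c∈
... | root = ≤-refl , ≤-<-trans (a<end a l) (a<end (end a l) r) , ≤-refl
... | left c∈l with a≤x , x<y , y≤p ← chords-bounds l c∈l =
  a≤x , x<y , ≤-trans y≤p (<⇒≤ (a<end (end a l) r))
... | right c∈r with p≤x , x<y , y≤b ← chords-bounds r c∈r =
  ≤-trans (<⇒≤ (a<end a l)) p≤x , x<y , y≤b

chords-unique : ∀ a t → Unique (chords a t)
chords-unique a leaf       = []
chords-unique a (node l r) =
  All.tabulate root∉ ∷ Unique.++⁺ (chords-unique a l) (chords-unique (end a l) r) disjoint
  where
  root∉ : ∀ {c} → c ∈ chords a l ++ chords (end a l) r → (a , end (end a l) r) ≢ c
  root∉ c∈ refl with ∈-++⁻ (chords a l) c∈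
  ... | inj₁ c∈l = <⇒≱ (a<end (end a l) r) (proj₂ (proj₂ (chords-bounds l c∈l)))
  ... | inj₂ c∈r = <⇒≱ (a<end a l) (proj₁ (chords-bounds r c∈r))
  disjoint : ∀ {c} → ¬ (c ∈ chords a l × c ∈ chords (end a l) r)
  disjoint (c∈l , c∈r)
    with _ , x<y , y≤p ← chords-bounds l c∈l | p≤x , _ , _ ← chords-bounds r c∈r =
    <⇒≱ (<-trans (n<1+n _) x<y) (≤-trans y≤p p≤x)

-- The two subtrees occupy intervals that meet only at the apex, and the root chord spans both;
-- alternation could thus happen only inside one subtree.
chords-nested : ∀ {a x y z w} t → (x , y) ∈ chords a t → (z , w) ∈ chords a t →
                ¬ (x < z × z < y × y < w)
chords-nested (node l r) c∈ d∈ (x<z , z<y , y<w) with ∈-node⁻ l r c∈ | ∈-node⁻ l r d∈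
... | root     | _        = <⇒≱ y<w (proj₂ (proj₂ (chords-bounds (node l r) d∈)))
... | _        | root     = <⇒≱ x<z (proj₁ (chords-bounds (node l r) c∈))
... | left c∈  | left d∈  = chords-nested l c∈ d∈ (x<z , z<y , y<w)
... | right c∈ | right d∈ = chords-nested r c∈ d∈ (x<z , z<y , y<w)
... | left c∈  | right d∈ =
  <⇒≱ z<y (≤-trans (proj₂ (proj₂ (chords-bounds l c∈))) (proj₁ (chords-bounds r d∈)))
... | right c∈ | left d∈  =
  <⇒≱ (<-trans (<-trans x<z z<y) y<w)
      (≤-trans (proj₂ (proj₂ (chords-bounds l d∈))) (proj₁ (chords-bounds r c∈)))

chords-noncrossing : ∀ {a c d} t → c ∈ chords a t → d ∈ chords a t → ¬ Crossing c d
chords-noncrossing t c∈ d∈ (inj₁ alternate) = chords-nested t c∈ d∈ alternate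
chords-noncrossing t c∈ d∈ (inj₂ alternate) = chords-nested t d∈ c∈ alternate

∈-left⁻ : ∀ {a x y} l r → y ≤ end a l → (x , y) ∈ chords a (node l r) → (x , y) ∈ chords a l
∈-left⁻ {a} l r y≤p c∈ with ∈-node⁻ l r c∈
... | root     = contradiction y≤p (<⇒≱ (a<end (end a l) r))
... | left c∈l = c∈l
... | right c∈r with p≤x , x<y , _ ← chords-bounds r c∈r =
  contradiction (≤-trans y≤p p≤x) (<⇒≱ (<-trans (n<1+n _) x<y))

∈-right⁻ : ∀ {a x y} l r → end a l ≤ x → (x , y) ∈ chords a (node l r) →
           (x , y) ∈ chords (end a l) r
∈-right⁻ {a} l r p≤x c∈ with ∈-node⁻ l r c∈
... | root      = contradiction p≤x (<⇒≱ (a<end a l))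
... | right c∈r = c∈r
... | left c∈l with _ , x<y , y≤p ← chords-bounds l c∈l =
  contradiction (≤-trans y≤p p≤x) (<⇒≱ (<-trans (n<1+n _) x<y))

-- An edge from a vertex before the apex `end a l` to the far end would leave the interval of the
-- left subtree, which only the root chord does, and that one starts at `a`; the other side is
-- symmetric. This identifies the triangles of a tree and also recovers the tree from its chords.
apex-unique : ∀ {a j} l r → let b = end (end a l) r in a < j → j < b →
              Edge a (node l r) (a , j) → Edge a (node l r) (j , b) → j ≡ end a l
apex-unique {a} {j} l r a<j j<b aj jb with <-cmp j (end a l)
... | tri≈ _ j≡p _ = j≡p
... | tri< j<p _ _ = contradiction jb no-edge
  where
  p<b = a<end (end a l) r
  no-edge : ¬ Edge a (node l r) (j , end (end a l) r)
  no-edge (inj₁ b≡1+j) = <⇒≱ (subst (end a l <_) b≡1+j p<b) j<p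
  no-edge (inj₂ c∈) = <⇒≱ a<j (proj₁ (j≤a (∈-node⁻ l r c∈)))
    where
    j≤a : ∈Node a l r (j , end (end a l) r) → j ≤ a × a ≤ a
    j≤a root        = ≤-refl , ≤-refl
    j≤a (left c∈l)  = contradiction (proj₂ (proj₂ (chords-bounds l c∈l))) (<⇒≱ p<b)
    j≤a (right c∈r) = contradiction (proj₁ (chords-bounds r c∈r)) (<⇒≱ j<p)
... | tri> _ _ p<j = contradiction aj no-edge
  where
  no-edge : ¬ Edge a (node l r) (a , j)
  no-edge (inj₁ refl) = <⇒≱ p<j (a<end a l)
  no-edge (inj₂ c∈) with ∈-node⁻ l r c∈
  ... | root      = <-irrefl refl j<b
  ... | left c∈l  = <⇒≱ p<j (proj₂ (proj₂ (chords-bounds l c∈l)))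
  ... | right c∈r = <⇒≱ (a<end a l) (proj₁ (chords-bounds r c∈r))

root-edge : ∀ a t → Edge a t (a , end a t)
root-edge a leaf       = inj₁ refl
root-edge a (node l r) = inj₂ (here refl)

Edge-map : ∀ {a a′ t t′ c} → (c ∈ chords a t → c ∈ chords a′ t′) → Edge a t c → Edge a′ t′ c
Edge-map f (inj₁ side) = inj₁ side
Edge-map f (inj₂ c∈)   = inj₂ (f c∈)

-- The longest side is the root chord of exactly one subtree; the other two sides stay within the
-- interval of that subtree, where `apex-unique` fixes the middle vertex.
∈-treeTriangles⁺ : ∀ {a x y z} t → x < y → y < z → Edge a t (x , y) → Edge a t (y , z) →
                   (x , z) ∈ chords a t → (x , y , z) ∈ treeTriangles a t
∈-treeTriangles⁺ {a} (node l r) x<y y<z xy yz xz with ∈-node⁻ l r xz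
... | root with refl ← apex-unique l r x<y y<z xy yz = here refl
... | left xz∈l = there (∈-++⁺ˡ (∈-treeTriangles⁺ l x<y y<z
        (Edge-map {a} {a} {node l r} {l} (∈-left⁻ l r (≤-trans (<⇒≤ y<z) z≤p)) xy)
        (Edge-map {a} {a} {node l r} {l} (∈-left⁻ l r z≤p) yz) xz∈l))
  where z≤p = proj₂ (proj₂ (chords-bounds l xz∈l))
... | right xz∈r = there (∈-++⁺ʳ (treeTriangles a l) (∈-treeTriangles⁺ r x<y y<z
        (Edge-map {a} {end a l} {node l r} {r} (∈-right⁻ l r p≤x) xy)
        (Edge-map {a} {end a l} {node l r} {r} (∈-right⁻ l r (≤-trans p≤x (<⇒≤ x<y))) yz) xz∈r))
  where p≤x = proj₁ (chords-bounds r xz∈r)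

∈-treeTriangles⁻ : ∀ {a x y z} t → (x , y , z) ∈ treeTriangles a t →
                   x < y × y < z × Edge a t (x , y) × Edge a t (y , z) × (x , z) ∈ chords a t
∈-treeTriangles⁻ {a} (node l r) (here refl) =
  a<end a l , a<end (end a l) r ,
  Edge-map {a} {a} {l} {node l r} (∈-left l r) (root-edge a l) ,
  Edge-map {end a l} {a} {r} {node l r} (∈-right l r) (root-edge (end a l) r) , here refl
∈-treeTriangles⁻ {a} (node l r) (there t∈) with ∈-++⁻ (treeTriangles a l) t∈
... | inj₁ t∈l with x<y , y<z , xy , yz , xz ← ∈-treeTriangles⁻ l t∈l =
  x<y , y<z , Edge-map {a} {a} {l} {node l r} (∈-left l r) xy ,
  Edge-map {a} {a} {l} {node l r} (∈-left l r) yz , ∈-left l r xz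
... | inj₂ t∈r with x<y , y<z , xy , yz , xz ← ∈-treeTriangles⁻ r t∈r =
  x<y , y<z , Edge-map {end a l} {a} {r} {node l r} (∈-right l r) xy ,
  Edge-map {end a l} {a} {r} {node l r} (∈-right l r) yz , ∈-right l r xz

longestSide : Triangle → Chord
longestSide (x , y , z) = x , z

-- Each internal node gives one triangle and one chord, the former lying just below the latter.
-- Uniqueness and number of the triangles are inherited from the chords.
longestSides≡chords : ∀ a t → map longestSide (treeTriangles a t) ≡ chords a t
longestSides≡chords a leaf       = refl
longestSides≡chords a (node l r) = cong ((a , end (end a l) r) ∷_) (trans
  (map-++ longestSide (treeTriangles a l) (treeTriangles (end a l) r))
  (cong₂ _++_ (longestSides≡chords a l) (longestSides≡chords (end a l) r)))

treeTriangles-unique : ∀ a t → Unique (treeTriangles a t)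
treeTriangles-unique a t =
  Unique.map⁻ (subst Unique (sym (longestSides≡chords a t)) (chords-unique a t))

length-treeTriangles : ∀ a t → length (treeTriangles a t) ≡ size t
length-treeTriangles a t = begin
  length (treeTriangles a t)                    ≡⟨ length-map longestSide (treeTriangles a t) ⟨
  length (map longestSide (treeTriangles a t))  ≡⟨ cong length (longestSides≡chords a t) ⟩
  length (chords a t)                           ≡⟨ length-chords a t ⟩
  size t                                        ∎
  where open ≡-Reasoning

sum-treeTriangles : ∀ {f : Triangle → ℕ} → (∀ x y z → f (x , y , z) ≡ y ∸ x) →
                    ∀ a t → sum (map f (treeTriangles a t)) ≡ weight t
sum-treeTriangles         f≡ a leaf       = refl
sum-treeTriangles {f = f} f≡ a (node l r) = begin
  f (a , end a l , end (end a l) r) + sum (map f (treeTriangles a l ++ treeTriangles (end a l) r))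
    ≡⟨ cong₂ _+_ (f≡ a (end a l) _) (sum-map-++ f (treeTriangles a l) _) ⟩
  end a l ∸ a + (sum (map f (treeTriangles a l)) + sum (map f (treeTriangles (end a l) r)))
    ≡⟨ cong₂ _+_ (trans (cong (_∸ a) (end≡ a l)) (m+n∸n≡m (suc (size l)) a))
                 (cong₂ _+_ (sum-treeTriangles f≡ a l) (sum-treeTriangles f≡ (end a l) r)) ⟩
  suc (size l) + (weight l + weight r)
    ≡⟨ +-assoc (suc (size l)) (weight l) (weight r) ⟨
  weight (node l r) ∎
  where open ≡-Reasoning

-- Inclusion in one direction suffices: the two shorter sides of the root triangle of `t` are then
-- edges of `t′`, so `apex-unique` equates the apexes and the subtrees can be compared separately.
chords-injective : ∀ a t t′ → end a t ≡ end a t′ →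
                   (∀ {c} → c ∈ chords a t → c ∈ chords a t′) → t ≡ t′
chords-injective a leaf       leaf         _  _ = refl
chords-injective a leaf       (node l r)   e  _ =
  contradiction (subst (end a l <_) (sym e) (a<end (end a l) r)) (≤⇒≯ (a<end a l))
chords-injective a (node l r) leaf         _  f with () ← f (here refl)
chords-injective a (node l r) (node l′ r′) e  f = cong₂ node
  (chords-injective a l l′ p≡p′ λ c∈ →
    ∈-left⁻ l′ r′ (subst (_ ≤_) p≡p′ (proj₂ (proj₂ (chords-bounds l c∈)))) (f (∈-left l r c∈)))
  (chords-injective (end a l) r r′ (trans e (cong (λ p → end p r′) (sym p≡p′))) λ {c} c∈ →
    subst (λ p → c ∈ chords p r′) (sym p≡p′)
      (∈-right⁻ l′ r′ (subst (_≤ _) p≡p′ (proj₁ (chords-bounds r c∈))) (f (∈-right l r c∈))))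
  where
  p≡p′ : end a l ≡ end a l′
  p≡p′ = apex-unique l′ r′ (a<end a l) (subst (end a l <_) e (a<end (end a l) r))
    (Edge-map {a} {a} {l} {node l′ r′} (f ∘ ∈-left l r) (root-edge a l))
    (subst (λ b → Edge a (node l′ r′) (end a l , b)) e
      (Edge-map {end a l} {a} {r} {node l′ r′} (f ∘ ∈-right l r) (root-edge (end a l) r)))

module _ {D : List Chord}
         (noncrossing : ∀ {c d} → c ∈ D → d ∈ D → ¬ Crossing c d)
         (proper : ∀ {x y} → (x , y) ∈ D → suc x < y)
         where

  furthestNeighbour : ∀ a b → suc a < b →
    ∃[ j ] a < j × j < b × (j ≡ suc a ⊎ (a , j) ∈ D) × (∀ {i} → j < i → i < b → (a , i) ∉ D)
  furthestNeighbour a b@(suc b′) (s<s a<b′) =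
    -- The search starts just below `b`, so the chord from `a` to `b` itself is never chosen. It
    -- descends and stops at `suc a` at the latest, which is joined to `a` by a side.
    search b′ a<b′ (n<1+n b′) (λ b′<i i<b → contradiction i<b (≤⇒≯ b′<i))
    where
    search : ∀ j → a < j → j < b → (∀ {i} → j < i → i < b → (a , i) ∉ D) →
      ∃[ j ] a < j × j < b × (j ≡ suc a ⊎ (a , j) ∈ D) × (∀ {i} → j < i → i < b → (a , i) ∉ D)
    search (suc j) (s≤s a≤j) j<b furthest with (a , suc j) ∈? D | m≤n⇒m<n∨m≡n a≤j
    ... | yes aj∈D | _         = suc j , s≤s a≤j , j<b , inj₂ aj∈D , furthest
    ... | no  _    | inj₂ refl = suc j , s≤s a≤j , j<b , inj₁ refl , furthest
    ... | no  aj∉D | inj₁ a<j  = search j a<j (<-trans (n<1+n j) j<b) furthest′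
      where
      furthest′ : ∀ {i} → j < i → i < b → (a , i) ∉ D
      furthest′ j<i i<b with m≤n⇒m<n∨m≡n j<i
      ... | inj₁ 1+j<i = furthest 1+j<i i<b
      ... | inj₂ refl  = aj∉D

  not-over : ∀ {a j x y} → j ≡ suc a ⊎ (a , j) ∈ D → a < x → x < j → j < y → (x , y) ∉ D
  not-over (inj₁ refl) a<x x<j j<y _    = <⇒≱ x<j a<x
  not-over (inj₂ aj∈D) a<x x<j j<y xy∈D = noncrossing aj∈D xy∈D (inj₁ (a<x , x<j , j<y))

  -- The apex of the triangle on ab is the furthest neighbour of a below b: a chord
  -- passing over it would start at a, or cross the chord from a to the apex.
  chords-cover : ∀ n a b → a < b → b ≤ n + a →
    ∃[ t ] end a t ≡ b × (∀ {x y} → (x , y) ∈ D → a ≤ x → y ≤ b → (x , y) ∈ chords a t)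
  -- `n` is fuel bounding the length b - a; the apex lies strictly between `a` and `b`, so both
  -- parts are shorter.
  chords-cover zero    a b a<b b≤a = contradiction a<b (≤⇒≯ b≤a)
  chords-cover (suc n) a b a<b b≤1+n+a with m≤n⇒m<n∨m≡n a<b
  ... | inj₂ refl = leaf , refl , λ xy∈D a≤x y≤b →
    contradiction (≤-trans (s≤s (s≤s a≤x)) (proper xy∈D)) (≤⇒≯ y≤b)
  ... | inj₁ 1+a<b
    with j , a<j , j<b , aj , furthest ← furthestNeighbour a b 1+a<b
    with l , refl , coverˡ ← chords-cover n a j a<j (s≤s⁻¹ (≤-trans j<b b≤1+n+a))
       | r , refl , coverʳ ← chords-cover n j b j<b
           (≤-trans b≤1+n+a (subst (_≤ n + j) (+-suc n a) (+-monoʳ-≤ n a<j))) =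
    node l r , refl , cover
    where
    cover : ∀ {x y} → (x , y) ∈ D → a ≤ x → y ≤ b → (x , y) ∈ chords a (node l r)
    cover {x} {y} xy∈D a≤x y≤b with y ≤? j | j ≤? x
    ... | yes y≤j | _       = ∈-left l r (coverˡ xy∈D a≤x y≤j)
    ... | no  _   | yes j≤x = ∈-right l r (coverʳ xy∈D j≤x y≤b)
    ... | no  y≰j | no  j≰x with m≤n⇒m<n∨m≡n a≤x | m≤n⇒m<n∨m≡n y≤b
    ...   | inj₂ refl | inj₂ refl = here refl
    ...   | inj₂ refl | inj₁ y<b  = contradiction xy∈D (furthest (≰⇒> y≰j) y<b)
    ...   | inj₁ a<x  | _         = contradiction xy∈D (not-over aj a<x (≰⇒> j≰x) (≰⇒> y≰j))

-- Triangulations as trees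

module _ {A : Set} where

  unique∧set⇒↭ : {xs ys : List A} → Unique xs → Unique ys →
                 (∀ {x} → x ∈ xs → x ∈ ys) → (∀ {x} → x ∈ ys → x ∈ xs) → xs ↭ ys
  unique∧set⇒↭ xs! ys! xs⊆ys ys⊆xs = ∼bag⇒↭ (unique∧set⇒bag xs! ys! (mk⇔ xs⊆ys ys⊆xs))

  map-unique : ∀ {B : Set} {f : A → B} {xs} → (∀ {x y} → x ∈ xs → y ∈ xs → f x ≡ f y → x ≡ y) →
               Unique xs → Unique (map f xs)
  map-unique                inj []           = []
  map-unique {xs = x ∷ xs} inj (x≢xs ∷ xs!) =
    All.map⁺ (All.tabulate λ y∈ fx≡fy → All.lookup x≢xs y∈ (inj (here refl) (there y∈) fx≡fy)) ∷
    map-unique (λ x∈ y∈ → inj (there x∈) (there y∈)) xs!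

  allPairs-tabulate : ∀ {R : A → A → Set} {xs} → (∀ {x y} → x ∈ xs → y ∈ xs → R x y) → AllPairs R xs
  allPairs-tabulate {xs = []}     r = []
  allPairs-tabulate {xs = x ∷ xs} r =
    All.tabulate (λ y∈ → r (here refl) (there y∈)) ∷ allPairs-tabulate (λ x∈ y∈ → r (there x∈) (there y∈))

  allPairs-lookup : ∀ {R : A → A → Set} {xs} → (∀ x → R x x) → (∀ {x y} → R x y → R y x) →
                    AllPairs R xs → ∀ {x y} → x ∈ xs → y ∈ xs → R x y
  allPairs-lookup rfl sm (r ∷ rs) (here refl) (here refl) = rfl _
  allPairs-lookup rfl sm (r ∷ rs) (here refl) (there y∈)  = All.lookup r y∈
  allPairs-lookup rfl sm (r ∷ rs) (there x∈)  (here refl) = sm (All.lookup r x∈)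
  allPairs-lookup rfl sm (r ∷ rs) (there x∈)  (there y∈)  = allPairs-lookup rfl sm rs x∈ y∈

  filter∈subsets : ∀ {P : A → Set} (P? : Decidable P) xs → filter P? xs ∈ subsets xs
  filter∈subsets P? []       = here refl
  filter∈subsets P? (x ∷ xs) with P? x
  ... | yes _ = ∈-++⁺ʳ (subsets xs) (∈-map⁺ (x ∷_) (filter∈subsets P? xs))
  ... | no  _ = ∈-++⁺ˡ (filter∈subsets P? xs)

  data ∈Subsets∷ (x : A) (xs : List A) : List A → Set where
    without   : ∀ {ys} → ys ∈ subsets xs → ∈Subsets∷ x xs ys
    including : ∀ {ys} → ys ∈ subsets xs → ∈Subsets∷ x xs (x ∷ ys)

  ∈-subsets∷⁻ : ∀ {x xs ys} → ys ∈ subsets (x ∷ xs) → ∈Subsets∷ x xs ys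
  ∈-subsets∷⁻ {x} {xs} ys∈ with ∈-++⁻ (subsets xs) ys∈
  ... | inj₁ ys∈′ = without ys∈′
  ... | inj₂ ys∈′ with _ , zs∈ , refl ← ∈-map⁻ (x ∷_) ys∈′ = including zs∈

  ∈-subsets⇒⊆ : ∀ {xs ys} → ys ∈ subsets xs → ∀ {y} → y ∈ ys → y ∈ xs
  ∈-subsets⇒⊆ {[]}     (here refl) ()
  ∈-subsets⇒⊆ {x ∷ xs} ys∈ y∈ with ∈-subsets∷⁻ {x} {xs} ys∈ | y∈
  ... | without ys∈′  | y∈        = there (∈-subsets⇒⊆ ys∈′ y∈)
  ... | including zs∈ | here refl = here refl
  ... | including zs∈ | there y∈′ = there (∈-subsets⇒⊆ zs∈ y∈′)

  ∈-subsets⇒unique : ∀ {xs ys} → Unique xs → ys ∈ subsets xs → Unique ys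
  ∈-subsets⇒unique {[]}     _            (here refl) = []
  ∈-subsets⇒unique {x ∷ xs} (x≢xs ∷ xs!) ys∈ with ∈-subsets∷⁻ {x} {xs} ys∈
  ... | without ys∈′  = ∈-subsets⇒unique xs! ys∈′
  ... | including zs∈ =
    All.tabulate (λ z∈ → All.lookup x≢xs (∈-subsets⇒⊆ zs∈ z∈)) ∷ ∈-subsets⇒unique xs! zs∈

  -- Members of `subsets xs` keep the order of `xs`, so their elements determine them as lists. This
  -- lets a triangulation be compared with a list built from a tree by membership alone.
  subsets-extensional : ∀ {xs ys zs} → Unique xs → ys ∈ subsets xs → zs ∈ subsets xs →
                        (∀ {x} → x ∈ ys → x ∈ zs) → (∀ {x} → x ∈ zs → x ∈ ys) → ys ≡ zs
  subsets-extensional {[]} _ (here refl) (here refl) _ _ = refl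
  subsets-extensional {x ∷ xs} x∷xs!@(_ ∷ xs!) ys∈ zs∈ ys⊆zs zs⊆ys
    with ∈-subsets∷⁻ {x} {xs} ys∈ | ∈-subsets∷⁻ {x} {xs} zs∈
  ... | without ys∈′   | without zs∈′   = subsets-extensional xs! ys∈′ zs∈′ ys⊆zs zs⊆ys
  ... | without ys∈′   | including _     =
    contradiction (∈-subsets⇒⊆ ys∈′ (zs⊆ys (here refl))) (Unique.Unique[x∷xs]⇒x∉xs x∷xs!)
  ... | including _    | without zs∈′   =
    contradiction (∈-subsets⇒⊆ zs∈′ (ys⊆zs (here refl))) (Unique.Unique[x∷xs]⇒x∉xs x∷xs!)
  ... | including ys∈′ | including zs∈′ = cong (x ∷_) (subsets-extensional xs! ys∈′ zs∈′
    (strip ys∈′ ys⊆zs) (strip zs∈′ zs⊆ys))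
    where
    strip : ∀ {us vs} → us ∈ subsets xs → (∀ {y} → y ∈ x ∷ us → y ∈ x ∷ vs) →
            ∀ {y} → y ∈ us → y ∈ vs
    strip us∈ us⊆vs y∈ with us⊆vs (there y∈)
    ... | here refl = contradiction (∈-subsets⇒⊆ us∈ y∈) (Unique.Unique[x∷xs]⇒x∉xs x∷xs!)
    ... | there y∈′ = y∈′

  subsets-unique : ∀ {xs} → Unique xs → Unique (subsets xs)
  subsets-unique {[]}     _              = [] ∷ []
  subsets-unique {x ∷ xs} x∷xs!@(_ ∷ xs!) =
    Unique.++⁺ (subsets-unique xs!) (Unique.map⁺ ∷-injectiveʳ (subsets-unique xs!)) disjoint
    where
    disjoint : ∀ {ys} → ¬ (ys ∈ subsets xs × ys ∈ map (x ∷_) (subsets xs))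
    disjoint (ys∈ , ys∈′) with _ , _ , refl ← ∈-map⁻ (x ∷_) ys∈′ =
      Unique.Unique[x∷xs]⇒x∉xs x∷xs! (∈-subsets⇒⊆ ys∈ (here refl))

  module _ (_≟′_ : DecidableEquality A) where
    open import Data.List.Membership.DecPropositional _≟′_ using () renaming (_∈?_ to _∈′?_)

    -- Pigeonhole: the entries of `ys` that lie in `xs` form a permutation of `xs`, and a missing
    -- `y` would make that list strictly shorter than `ys`.
    unique∧⊆∧length⇒⊇ : ∀ {xs ys : List A} → Unique xs → Unique ys → (∀ {x} → x ∈ xs → x ∈ ys) →
                        length ys ≤ length xs → ∀ {y} → y ∈ ys → y ∈ xs
    unique∧⊆∧length⇒⊇ {xs} {ys} xs! ys! xs⊆ys ys≤xs {y} y∈ys with y ∈′? xs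
    ... | yes y∈xs = y∈xs
    ... | no  y∉xs = contradiction
      (filter-notAll (_∈′? xs) ys (Any.map (λ { refl → y∉xs }) y∈ys))
      (≤⇒≯ (subst (length ys ≤_) (↭.↭-length xs↭) ys≤xs))
      where
      xs↭ : xs ↭ filter (_∈′? xs) ys
      xs↭ = unique∧set⇒↭ xs! (Unique.filter⁺ (_∈′? xs) ys!)
        (λ x∈ → ∈-filter⁺ (_∈′? xs) (xs⊆ys x∈) x∈) (proj₂ ∘ ∈-filter⁻ (_∈′? xs) {xs = ys})

∈-vertices⁺ : ∀ {n x} → 1 ≤ x → x ≤ n → x ∈ vertices n
∈-vertices⁺ {x = suc x} _ x<n = ∈-map⁺ suc (∈-upTo⁺ x<n)

∈-vertices⁻ : ∀ {n x} → x ∈ vertices n → 1 ≤ x × x ≤ n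
∈-vertices⁻ x∈ with _ , y∈ , refl ← ∈-map⁻ suc x∈ = s≤s z≤n , ∈-upTo⁻ y∈

vertices-unique : ∀ n → Unique (vertices n)
vertices-unique n = Unique.map⁺ suc-injective (Unique.upTo⁺ n)

∈-diagonals⁺ : ∀ {n a b} → 1 ≤ a → b ≤ n → IsDiagonal n (a , b) → (a , b) ∈ diagonals n
∈-diagonals⁺ {n} 1≤a b≤n d@(a<b , _) = ∈-filter⁺ (isDiagonal? n)
  (∈-cartesianProduct⁺ (∈-vertices⁺ 1≤a (≤-trans (<⇒≤ a<b) b≤n))
                       (∈-vertices⁺ (≤-trans 1≤a (<⇒≤ a<b)) b≤n)) d

∈-diagonals⁻ : ∀ {n a b} → (a , b) ∈ diagonals n → 1 ≤ a × b ≤ n × IsDiagonal n (a , b)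
∈-diagonals⁻ {n} ab∈
  with ab∈′ , d ← ∈-filter⁻ (isDiagonal? n) {xs = cartesianProduct (vertices n) (vertices n)} ab∈
  with a∈ , b∈ ← ∈-cartesianProduct⁻ (vertices n) (vertices n) ab∈′ =
  proj₁ (∈-vertices⁻ a∈) , proj₂ (∈-vertices⁻ {n} b∈) , d

diagonals-unique : ∀ n → Unique (diagonals n)
diagonals-unique n = Unique.filter⁺ (isDiagonal? n)
  (Unique.cartesianProduct⁺ (vertices-unique n) (vertices-unique n))

triangles-unique : ∀ n D → Unique (triangles n D)
triangles-unique n D = Unique.filter⁺ (isTriangleOf? n D)
  (Unique.cartesianProduct⁺ (vertices-unique n)
    (Unique.cartesianProduct⁺ (vertices-unique n) (vertices-unique n)))

triangulations-unique : ∀ n → Unique (triangulations n)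
triangulations-unique n = Unique.filter⁺ (isTriangulation? n) (subsets-unique (diagonals-unique n))

noncrossing-refl : ∀ c → Noncrossing c c
noncrossing-refl c (inj₁ (a<a , _)) = <-irrefl refl a<a
noncrossing-refl c (inj₂ (a<a , _)) = <-irrefl refl a<a

noncrossing-sym : ∀ {c d} → Noncrossing c d → Noncrossing d c
noncrossing-sym ¬cd (inj₁ alternate) = ¬cd (inj₂ alternate)
noncrossing-sym ¬cd (inj₂ alternate) = ¬cd (inj₁ alternate)

-- Filtering `diagonals n`, rather than deleting from `chords 1 t`, puts the result literally into
-- `subsets (diagonals n)`. For a tree spanning the polygon it drops exactly the root chord, which
-- is the side from 1 to `n`.
treeDiagonals : ℕ → Tree → List Chord
treeDiagonals n t = filter (_∈? chords 1 t) (diagonals n)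

module _ {n k : ℕ} (n≡3+k : n ≡ 3 + k) where

  end≡n : ∀ {t} → size t ≡ suc k → end 1 t ≡ n
  end≡n {t} size≡ = trans (end≡ 1 t)
    (trans (cong (λ s → suc s + 1) size≡) (trans (+-comm (suc (suc k)) 1) (sym n≡3+k)))

  module _ {t : Tree} (size≡ : size t ≡ suc k) where

    ∈-treeDiagonals⁻ : ∀ {c} → c ∈ treeDiagonals n t → c ∈ chords 1 t × c ≢ (1 , n)
    ∈-treeDiagonals⁻ c∈ with c∈diagonals , c∈t ← ∈-filter⁻ (_∈? chords 1 t) {xs = diagonals n} c∈ =
      c∈t , λ { refl → proj₂ (proj₂ (proj₂ (∈-diagonals⁻ c∈diagonals))) (inj₂ (refl , refl)) }

    ∈-treeDiagonals⁺ : ∀ {c} → c ∈ chords 1 t → c ≢ (1 , n) → c ∈ treeDiagonals n t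
    ∈-treeDiagonals⁺ c∈ c≢1n with 1≤x , x<y , y≤n ← chords-bounds t c∈ =
      ∈-filter⁺ (_∈? chords 1 t)
        (∈-diagonals⁺ 1≤x (subst (_ ≤_) (end≡n size≡) y≤n) (<-trans (n<1+n _) x<y , not-side)) c∈
      where
      not-side : ¬ IsSide n _
      not-side (inj₁ refl)          = <-irrefl refl x<y
      not-side (inj₂ (refl , refl)) = c≢1n refl

    1n∈chords : (1 , n) ∈ chords 1 t
    1n∈chords with subst (λ b → Edge 1 t (1 , b)) (end≡n size≡) (root-edge 1 t)
    ... | inj₁ n≡2 with () ← trans (sym n≡3+k) n≡2
    ... | inj₂ 1n∈ = 1n∈

    length-treeDiagonals : length (treeDiagonals n t) ≡ k
    length-treeDiagonals = suc-injective (begin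
      suc (length (treeDiagonals n t))     ≡⟨ ↭.↭-length perm ⟩
      length (chords 1 t)                  ≡⟨ length-chords 1 t ⟩
      size t                               ≡⟨ size≡ ⟩
      suc k                                ∎)
      where
      open ≡-Reasoning
      to : ∀ {c} → c ∈ (1 , n) ∷ treeDiagonals n t → c ∈ chords 1 t
      to (here refl) = 1n∈chords
      to (there c∈)  = proj₁ (∈-treeDiagonals⁻ c∈)
      from : ∀ {c} → c ∈ chords 1 t → c ∈ (1 , n) ∷ treeDiagonals n t
      from {c} c∈ with ≡-dec _≟_ _≟_ c (1 , n)
      ... | yes c≡1n = here c≡1n
      ... | no  c≢1n = there (∈-treeDiagonals⁺ c∈ c≢1n)
      perm : (1 , n) ∷ treeDiagonals n t ↭ chords 1 t
      perm = unique∧set⇒↭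
        (All.tabulate (λ c∈ 1n≡c → proj₂ (∈-treeDiagonals⁻ c∈) (sym 1n≡c)) ∷
          Unique.filter⁺ (_∈? chords 1 t) (diagonals-unique n))
        (chords-unique 1 t) to from

    IsEdge⇒Edge : ∀ {c} → IsEdge n (treeDiagonals n t) c → Edge 1 t c
    IsEdge⇒Edge (inj₁ (inj₁ side))          = inj₁ side
    IsEdge⇒Edge (inj₁ (inj₂ (refl , refl))) = inj₂ 1n∈chords
    IsEdge⇒Edge (inj₂ c∈)                   = inj₂ (proj₁ (∈-treeDiagonals⁻ c∈))

    Edge⇒IsEdge : ∀ {c} → Edge 1 t c → IsEdge n (treeDiagonals n t) c
    Edge⇒IsEdge     (inj₁ side) = inj₁ (inj₁ side)
    Edge⇒IsEdge {c} (inj₂ c∈) with ≡-dec _≟_ _≟_ c (1 , n)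
    ... | yes refl = inj₁ (inj₂ (refl , refl))
    ... | no  c≢1n = inj₂ (∈-treeDiagonals⁺ c∈ c≢1n)

    triangles↭treeTriangles : triangles n (treeDiagonals n t) ↭ treeTriangles 1 t
    triangles↭treeTriangles =
      unique∧set⇒↭ (triangles-unique n (treeDiagonals n t)) (treeTriangles-unique 1 t) to from
      where
      triangle? = isTriangleOf? n (treeDiagonals n t)
      V = vertices n
      to : ∀ {τ} → τ ∈ triangles n (treeDiagonals n t) → τ ∈ treeTriangles 1 t
      to τ∈ with (x<y , y<z) , xy , yz , xz ← proj₂ (∈-filter⁻ triangle?
                   {xs = cartesianProduct V (cartesianProduct V V)} τ∈)
        with IsEdge⇒Edge xz
      -- A vertex lies strictly between `x` and `z`, so the longest side does not join consecutive
      -- vertices and must be a chord of the tree.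
      ... | inj₁ refl = contradiction y<z (≤⇒≯ x<y)
      ... | inj₂ xz∈  = ∈-treeTriangles⁺ t x<y y<z (IsEdge⇒Edge xy) (IsEdge⇒Edge yz) xz∈
      from : ∀ {τ} → τ ∈ treeTriangles 1 t → τ ∈ triangles n (treeDiagonals n t)
      from τ∈ with x<y , y<z , xy , yz , xz ← ∈-treeTriangles⁻ t τ∈
        with 1≤x , _ , z≤end ← chords-bounds t xz =
        ∈-filter⁺ triangle?
          (∈-cartesianProduct⁺ (∈-vertices⁺ 1≤x (≤-trans (<⇒≤ x<y) y≤n′))
            (∈-cartesianProduct⁺ (∈-vertices⁺ 1≤y y≤n′)
                                 (∈-vertices⁺ (≤-trans 1≤y (<⇒≤ y<z)) z≤n′)))
          ((x<y , y<z) , Edge⇒IsEdge xy , Edge⇒IsEdge yz , Edge⇒IsEdge (inj₂ xz))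
        where
        z≤n′ = subst (_ ≤_) (end≡n size≡) z≤end
        y≤n′ = ≤-trans (<⇒≤ y<z) z≤n′
        1≤y = ≤-trans 1≤x (<⇒≤ x<y)

    𝒮-treeDiagonals : 𝒮 n (treeDiagonals n t) ≡ weight t
    𝒮-treeDiagonals = trans (sum-↭ (↭.map⁺ _ triangles↭treeTriangles))
                            (sum-treeTriangles (λ _ _ _ → refl) 1 t)

    treeDiagonals-triangulation : treeDiagonals n t ∈ triangulations n
    treeDiagonals-triangulation = ∈-filter⁺ (isTriangulation? n)
      (filter∈subsets (_∈? chords 1 t) (diagonals n))
      ( trans length-treeDiagonals (sym (cong (_∸ 3) n≡3+k))
      , allPairs-tabulate (λ c∈ d∈ → chords-noncrossing t (proj₁ (∈-treeDiagonals⁻ c∈))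
                                                          (proj₁ (∈-treeDiagonals⁻ d∈)))
      , trans (↭.↭-length triangles↭treeTriangles)
          (trans (length-treeTriangles 1 t) (trans size≡ (sym (cong (_∸ 2) n≡3+k)))))

  treeDiagonals-injective : ∀ {t t′} → size t ≡ suc k → size t′ ≡ suc k →
                            treeDiagonals n t ≡ treeDiagonals n t′ → t ≡ t′
  treeDiagonals-injective {t} {t′} size≡ size≡′ D≡D′ =
    chords-injective 1 t t′ (trans (end≡n size≡) (sym (end≡n size≡′))) chords⊆
    where
    chords⊆ : ∀ {c} → c ∈ chords 1 t → c ∈ chords 1 t′
    chords⊆ {c} c∈ with ≡-dec _≟_ _≟_ c (1 , n)
    ... | yes refl = 1n∈chords size≡′
    ... | no  c≢1n =
      proj₁ (∈-treeDiagonals⁻ size≡′ (subst (c ∈_) D≡D′ (∈-treeDiagonals⁺ size≡ c∈ c≢1n)))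

  -- The chords of D lie among those of a tree; as they are equally many, they agree.
  triangulation⇒tree : ∀ {D} → D ∈ triangulations n → ∃[ t ] size t ≡ suc k × D ≡ treeDiagonals n t
  triangulation⇒tree {D} D∈
    with D∈subsets , length≡ , pairwise , _ ← ∈-filter⁻ (isTriangulation? n) {xs = subsets (diagonals n)} D∈
    = fromCover (chords-cover noncrossing proper n 1 n 1<n (m≤m+n n 1))
    where
    1<n : 1 < n
    1<n = subst (1 <_) (sym n≡3+k) (s≤s (s≤s z≤n))
    noncrossing : ∀ {c d} → c ∈ D → d ∈ D → ¬ Crossing c d
    noncrossing = allPairs-lookup noncrossing-refl noncrossing-sym pairwise
    diagonal : ∀ {x y} → (x , y) ∈ D → 1 ≤ x × y ≤ n × IsDiagonal n (x , y)
    diagonal c∈ = ∈-diagonals⁻ (∈-subsets⇒⊆ D∈subsets c∈)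
    proper : ∀ {x y} → (x , y) ∈ D → suc x < y
    proper c∈ with _ , _ , x<y , not-side ← diagonal c∈ =
      ≤∧≢⇒< x<y (λ 1+x≡y → not-side (inj₁ (sym 1+x≡y)))
    fromCover : ∃[ t ] end 1 t ≡ n ×
                  (∀ {x y} → (x , y) ∈ D → 1 ≤ x → y ≤ n → (x , y) ∈ chords 1 t) →
                ∃[ t ] size t ≡ suc k × D ≡ treeDiagonals n t
    fromCover (t , end≡n′ , cover) = t , size≡ ,
      subsets-extensional {xs = diagonals n} (diagonals-unique n) D∈subsets
        (filter∈subsets (_∈? chords 1 t) (diagonals n))
        D⊆ (unique∧⊆∧length⇒⊇ (≡-dec _≟_ _≟_) (∈-subsets⇒unique (diagonals-unique n) D∈subsets)
              (Unique.filter⁺ (_∈? chords 1 t) (diagonals-unique n)) D⊆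
              (≤-reflexive (trans (length-treeDiagonals size≡) (sym (trans length≡ (cong (_∸ 3) n≡3+k))))))
      where
      size≡ : size t ≡ suc k
      size≡ = suc-injective (+-cancelʳ-≡ 1 _ _
        (trans (sym (end≡ 1 t)) (trans end≡n′ (trans n≡3+k (+-comm 1 (suc (suc k)))))))
      D⊆ : ∀ {c} → c ∈ D → c ∈ treeDiagonals n t
      D⊆ c∈ with 1≤x , y≤n , _ ← diagonal c∈ =
        ∈-filter⁺ (_∈? chords 1 t) (∈-subsets⇒⊆ {xs = diagonals n} D∈subsets c∈) (cover c∈ 1≤x y≤n)

  triangulations↭trees : triangulations n ↭ map (treeDiagonals n) (trees (suc k))
  triangulations↭trees = unique∧set⇒↭ (triangulations-unique n)
    (map-unique (λ t∈ t′∈ → treeDiagonals-injective (∈-trees⁻ {suc k} t∈) (∈-trees⁻ {suc k} t′∈))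
                (treesBelow-unique (suc (suc k)) (suc k)))
    to from
    where
    to : ∀ {D} → D ∈ triangulations n → D ∈ map (treeDiagonals n) (trees (suc k))
    to D∈ with t , size≡ , refl ← triangulation⇒tree D∈ =
      ∈-map⁺ (treeDiagonals n) (subst (λ j → t ∈ trees j) size≡ (∈-trees⁺ t))
    from : ∀ {D} → D ∈ map (treeDiagonals n) (trees (suc k)) → D ∈ triangulations n
    from D∈ with t , t∈ , refl ← ∈-map⁻ (treeDiagonals n) D∈ =
      treeDiagonals-triangulation (∈-trees⁻ {suc k} t∈)

  length-triangulations : length (triangulations n) ≡ countTrees (suc k)
  length-triangulations = trans (↭.↭-length triangulations↭trees) (length-map _ (trees (suc k)))

  sum-𝒮 : sum (map (𝒮 n) (triangulations n)) ≡ totalWeight (suc k)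
  sum-𝒮 = trans (sum-↭ (↭.map⁺ (𝒮 n) triangulations↭trees))
                (𝒮≗weight (trees (suc k)) (∈-trees⁻ {suc k}))
    where
    𝒮≗weight : ∀ ts → (∀ {t} → t ∈ ts → size t ≡ suc k) →
               sum (map (𝒮 n) (map (treeDiagonals n) ts)) ≡ sum (map weight ts)
    𝒮≗weight []       _     = refl
    𝒮≗weight (t ∷ ts) size≡ =
      cong₂ _+_ (𝒮-treeDiagonals (size≡ (here refl))) (𝒮≗weight ts (size≡ ∘ there))

-- The expectation

-- Pascal's rule in the even row, where the two entries above the middle are equal by symmetry.
centralBinomial-half : ∀ k → 2 * (suc (2 * k) C suc k) ≡ (2 * suc k) C suc k
centralBinomial-half k = begin
  2 * b                        ≡⟨ cong (λ z → b + z) (+-identityʳ b) ⟩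
  b + b                        ≡⟨ cong (_+ b) mirror ⟨
  (suc (2 * k) C k) + b        ≡⟨ nCk+nC[k+1]≡[n+1]C[k+1] (suc (2 * k)) k ⟩
  suc (suc (2 * k)) C suc k    ≡⟨ cong (_C suc k) (2+2k k) ⟩
  (2 * suc k) C suc k          ∎
  where
  open ≡-Reasoning
  b = suc (2 * k) C suc k
  2+2k : ∀ k → suc (suc (2 * k)) ≡ 2 * suc k
  2+2k = solve-∀
  split : ∀ k → suc (2 * k) ≡ suc k + k
  split = solve-∀
  mirror : suc (2 * k) C k ≡ b
  mirror = trans (nCk≡nC[n∸k] (≤-trans (m≤m+n k (k + 0)) (n≤1+n (2 * k))))
    (cong (suc (2 * k) C_) (trans (cong (_∸ k) (split k)) (m+n∸n≡m (suc k) k)))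

-- Half of the closed form at `suc k`. With n = k + 3 the exponent 2k + 1 is 2n - 5 and the lower
-- index k + 1 is n - 2.
totalWeight-numerator : ∀ k → totalWeight (suc k) + (suc (2 * k) C suc k) ≡ 2 ^ suc (2 * k)
totalWeight-numerator k = *-cancelˡ-≡ _ _ 2 (begin
  2 * (totalWeight (suc k) + (suc (2 * k) C suc k))      ≡⟨ *-distribˡ-+ 2 (totalWeight (suc k)) _ ⟩
  2 * totalWeight (suc k) + 2 * (suc (2 * k) C suc k)    ≡⟨ cong (λ z → 2 * totalWeight (suc k) + z) (centralBinomial-half k) ⟩
  2 * totalWeight (suc k) + ((2 * suc k) C suc k)        ≡⟨ totalWeight-closed (suc k) ⟩
  4 ^ suc k                                              ≡⟨ ^-*-assoc 2 2 (suc k) ⟩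
  2 ^ (2 * suc k)                                        ≡⟨ cong (2 ^_) (2+2k k) ⟩
  2 * 2 ^ suc (2 * k)                                    ∎)
  where
  open ≡-Reasoning
  2+2k : ∀ k → 2 * suc k ≡ suc (suc (2 * k))
  2+2k = solve-∀

m+n≡o⇒o-n≡m : ∀ {m n o} → m + n ≡ o → + o - + n ≡ + m
m+n≡o⇒o-n≡m {m} {n} refl = begin
  + (m + n) - + n   ≡⟨ ℤ.[+m]-[+n]≡m⊖n (m + n) n ⟩
  (m + n) ℤ.⊖ n     ≡⟨ ℤ.⊖-≥ (m≤n+m n m) ⟩
  + (m + n ∸ n)     ≡⟨ cong +_ (m+n∸n≡m m n) ⟩
  + m               ∎
  where open ≡-Reasoning

-- The operation `_/_` reduces to lowest terms, which hides numerator and denominator; in the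
-- unnormalised rationals the claim is the cross multiplication `eq`.
fraction-* : ∀ a m b n c → a * b ≡ c * (suc m * suc n) →
             (+ a / suc m) ℚ.* (+ b / suc n) ≡ + c / 1
fraction-* a m b n c eq = ℚ.toℚᵘ-injective (begin-equality
  ℚ.toℚᵘ (p ℚ.* q)               ≃⟨ ℚ.toℚᵘ-homo-* p q ⟩
  ℚ.toℚᵘ p ℚᵘ.* ℚ.toℚᵘ q         ≃⟨ ℚᵘ.*-cong (ℚ.toℚᵘ-fromℚᵘ pᵘ) (ℚ.toℚᵘ-fromℚᵘ qᵘ) ⟩
  pᵘ ℚᵘ.* qᵘ                     ≃⟨ ℚᵘ.*≡* cross ⟩
  ℚᵘ.mkℚᵘ (+ c) 0                ≃⟨ ℚ.toℚᵘ-fromℚᵘ (ℚᵘ.mkℚᵘ (+ c) 0) ⟨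
  ℚ.toℚᵘ (+ c / 1)               ∎)
  where
  open ℚᵘ.≤-Reasoning
  pᵘ = ℚᵘ.mkℚᵘ (+ a) m
  qᵘ = ℚᵘ.mkℚᵘ (+ b) n
  p = + a / suc m
  q = + b / suc n
  cross : (+ a ℤ.* + b) ℤ.* + 1 ≡ + c ℤ.* + (suc m * suc n)
  cross = trans (ℤ.*-identityʳ _)
    (trans (sym (ℤ.pos-* a b)) (trans (cong +_ eq) (ℤ.pos-* c (suc m * suc n))))

*≡⇒≡÷ : ∀ {x y z} .{{_ : ℚ.NonZero z}} → x ℚ.* z ≡ y → x ≡ y ÷ z
*≡⇒≡÷ {x} {z = z} refl = begin
  x                       ≡⟨ ℚ.*-identityʳ x ⟨
  x ℚ.* ℚ.1ℚ              ≡⟨ cong (x ℚ.*_) (ℚ.*-inverseʳ z) ⟨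
  x ℚ.* (z ℚ.* ℚ.1/ z)    ≡⟨ ℚ.*-assoc x z (ℚ.1/ z) ⟨
  x ℚ.* z ℚ.* ℚ.1/ z      ∎
  where open ≡-Reasoning

-- `𝔼` unfolds to a fraction only on a nonempty list, so the list is matched here, while still a
-- variable.
𝔼-*-fraction : ∀ {A : Set} (xs : List A) f b n c → NonZero (length xs) →
               sum (map f xs) * b ≡ c * (length xs * suc n) →
               𝔼 xs f ℚ.* (+ b / suc n) ≡ + c / 1
𝔼-*-fraction (x ∷ xs) f b n c _ = fraction-* (sum (map f (x ∷ xs))) (length xs) b n c

-- `catalan k` is given by a binomial coefficient and the expectation by a count;
-- `countTrees-closed` shows that they agree. Multiplying the expectation by `catalan k` then
-- cancels the number of trees and leaves the total weight.
𝔼-trees : ∀ {A : Set} (xs : List A) f k →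
          length xs ≡ countTrees k → sum (map f xs) ≡ totalWeight k →
          𝔼 xs f ≡ ((+ totalWeight k / 1) ÷ catalan k) {{catalan≢0 k}}
𝔼-trees xs f k length≡ sum≡ = *≡⇒≡÷ {{catalan≢0 k}}
  (𝔼-*-fraction xs f ((2 * k) C k) k (totalWeight k) length≢0 (begin
    sum (map f xs) * ((2 * k) C k)           ≡⟨ cong₂ _*_ sum≡ (sym (countTrees-closed k)) ⟩
    totalWeight k * (suc k * countTrees k)   ≡⟨ cong (totalWeight k *_) (*-comm (suc k) (countTrees k)) ⟩
    totalWeight k * (countTrees k * suc k)   ≡⟨ cong (λ c → totalWeight k * (c * suc k)) length≡ ⟨
    totalWeight k * (length xs * suc k)      ∎))
  where
  open ≡-Reasoning
  length≢0 : NonZero (length xs)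
  length≢0 = subst NonZero (sym length≡) (m*n≢0⇒n≢0 (suc k)
    {{subst NonZero (sym (countTrees-closed k)) (k≤n⇒nCk≢0 (m≤m+n k (k + 0)))}})

2n∸5 : ∀ k → 2 * (3 + k) ∸ 5 ≡ suc (2 * k)
2n∸5 k = cong (_∸ 5) (shift k)
  where
  shift : ∀ k → 2 * (3 + k) ≡ 6 + 2 * k
  shift = solve-∀

numerator : ∀ k → let n = 3 + k in
            + (2 ^ (2 * n ∸ 5)) - + ((2 * n ∸ 5) C (n ∸ 2)) ≡ + totalWeight (suc k)
numerator k = trans (cong (λ m → + (2 ^ m) - + (m C suc k)) (2n∸5 k))
                    (m+n≡o⇒o-n≡m (totalWeight-numerator k))

lemma7 : (n : ℕ) → 3 ≤ n →
    𝔼 (triangulations n) (𝒮 n)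
    ≡ (((+ (2 ^ (2 * n ∸ 5)) - + ((2 * n ∸ 5) C (n ∸ 2))) / 1) ÷ catalan (n ∸ 2))
    {{catalan≢0 (n ∸ 2)}}
lemma7 (suc (suc (suc k))) _ = trans
  (𝔼-trees (triangulations n) (𝒮 n) (suc k) (length-triangulations {k = k} refl) (sum-𝒮 {k = k} refl))
  (cong (λ z → ((z / 1) ÷ catalan (suc k)) {{catalan≢0 (suc k)}}) (sym (numerator k)))
  where n = 3 + k
lemma7 (suc (suc zero)) (s≤s (s≤s ()))
lemma7 (suc zero) (s≤s ())
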